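{- The CCV $\lambda\mu$-calculus has the Church–Rosser property: if $M_1=_{ccv}M_2$, then there is a term $N$ with $M_1\to^* N$ and $M_2\to^* N$.
   Context: CCV $\lambda\mu$-calculus. Ordinary variables $x,y,z,\dots$ and continuation variables $k,l,\dots$ form disjoint sets. Terms $M ::= x \mid \lambda x.M \mid MM \mid (M\ \mathsf{where}\ x:=M) \mid \mu k.J$, jumps $J ::= [k]M \mid (J\ \mathsf{where}\ x:=M)$, where $(L\ \mathsf{where}\ x:=M)$ means $\mathsf{let}\ x=M\ \mathsf{in}\ L$; $\lambda x$ binds $x$ in its body, $\mathsf{where}\ x:=M$ binds $x$ in the body $L$ (or $J$) only, $\mu k$ binds $k$. Terms are identified up to $\alpha$-conversion and the congruence generated by (E1) $(L\ \mathsf{where}\ x:=(M\ \mathsf{where}\ y:=N))=((L\ \mathsf{where}\ x:=M)\ \mathsf{where}\ y:=N)$ if $y$ not free in $L$; (E2) $((\mu k.J)\ \mathsf{where}\ x:=M)=\mu k.(J\ \mathsf{where}\ x:=M)$ if $k$ not free in $M$; (E3) $[k](L\ \mathsf{where}\ x:=M)=([k]L\ \mathsf{where}\ x:=M)$. Values $V$: variables and $\lambda$-abstractions; $N$ denotes a non-value. Reduction rules ($z$ fresh): $NM\to(zM\ \mathsf{where}\ z:=N)$; $VN\to(Vz\ \mathsf{where}\ z:=N)$; $(\lambda x.M)V\to(M\ \mathsf{where}\ x:=V)$; $(M\ \mathsf{where}\ x:=V)\to M\{V/x\}$; $(M\ \mathsf{where}\ x:=\mu k.J)\to\mu k.J\{[k]\square\mapsto[k](M\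 \mathsf{where}\ x:=\square)\}$; $[l]\mu k.J\to J\{l/k\}$; $\lambda x.Vx\to V$ ($x$ not free in $V$); $(x\ \mathsf{where}\ x:=M)\to M$; $\mu k.[k]M\to M$ ($k$ not free in $M$). Here $J\{[k]\square\mapsto[k](M\ \mathsf{where}\ x:=\square)\}$ replaces recursively each subjump $[k]Q$ with $k$ free by $[k](M\ \mathsf{where}\ x:=Q)$ (capture-avoiding) and $J\{l/k\}$ replaces each such $[k]Q$ by $[l]Q$. $\to$ is the compatible closure, $\to^*$ its reflexive-transitive closure, and $=_{ccv}$ the smallest congruence containing the rules. -}

module Defs where

open import Data.Fin using (Fin; zero; suc; lift; _≟_)
open import Data.Nat using (ℕ; suc)
open import Data.Product using (∃₂; _×_)
open import Data.Sum using (_⊎_)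
open import Function using (id)
open import Relation.Nullary using (¬_; yes; no)

data Sort : Set where
  trm jmp : Sort

private
  variable
    s : Sort
    n n′ m m′ : ℕ

-- Well-scoped de Bruijn syntax, so that α-equivalence is propositional
-- equality.  In Exp s n m, the free ordinary variables are drawn from Fin n
-- and the free continuation variables from Fin m.
-- L where:= M is (L where x := M), with x being index zero in L; the body L
-- is a term or a jump according to s.

infixl 7 _·_
infixl 6 _where:=_
infixr 5 ƛ_ μ_ [_]_

data Exp : Sort → ℕ → ℕ → Set where
  var      : Fin n → Exp trm n m
  ƛ_       : Exp trm (suc n) m → Exp trm n m
  _·_      : Exp trm n m → Exp trm n m → Exp trm n m
  _where:=_ : Exp s (suc n) m → Exp trm n m → Exp s n m
  μ_       : Exp jmp n (suc m) → Exp trm n m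
  [_]_     : Fin m → Exp trm n m → Exp jmp n m

Term Jump : ℕ → ℕ → Set
Term = Exp trm
Jump = Exp jmp

data Value : Term n m → Set where
  var : (x : Fin n) → Value {n} {m} (var x)
  ƛ_  : (M : Term (suc n) m) → Value (ƛ M)

NonValue : Term n m → Set
NonValue M = ¬ Value M

-- Simultaneous renaming of ordinary and continuation variables.
ren : (Fin n → Fin n′) → (Fin m → Fin m′) → Exp s n m → Exp s n′ m′
ren ρ κ (var x)       = var (ρ x)
ren ρ κ (ƛ M)         = ƛ ren (lift 1 ρ) κ M
ren ρ κ (M · N)       = ren ρ κ M · ren ρ κ N
ren ρ κ (L where:= M) = ren (lift 1 ρ) κ L where:= ren ρ κ M
ren ρ κ (μ J)         = μ ren ρ (lift 1 κ) J
ren ρ κ ([ k ] M)     = [ κ k ] ren ρ κ M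

-- Weakening; "z not free" / "k not free" side conditions are expressed by
-- being in the image of these.
wk : Exp s n m → Exp s (suc n) m
wk = ren suc id

wkᶜ : Exp s n m → Exp s n (suc m)
wkᶜ = ren id suc

-- Weakening that keeps index zero fixed and inserts a fresh index one.
wk₁ : Exp s (suc n) m → Exp s (suc (suc n)) m
wk₁ = ren (lift 1 suc) id

exts : (Fin n → Term n′ m) → Fin (suc n) → Term (suc n′) m
exts σ zero    = var zero
exts σ (suc x) = wk (σ x)

sub : (Fin n → Term n′ m) → Exp s n m → Exp s n′ m
sub σ (var x)       = σ x
sub σ (ƛ M)         = ƛ sub (exts σ) M
sub σ (M · N)       = sub σ M · sub σ N
sub σ (L where:= M) = sub (exts σ) L where:= sub σ M
sub σ (μ J)         = μ sub (λ x → wkᶜ (σ x)) J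
sub σ ([ k ] M)     = [ k ] sub σ M

-- M ⟨ V ⟩ is M{V/x}, with x being index zero in M.
_⟨_⟩ : Exp s (suc n) m → Term n m → Exp s n m
_⟨_⟩ {n = n} {m = m} M V = sub σ M
  where
  σ : Fin (suc n) → Term n m
  σ zero    = V
  σ (suc x) = var x

-- J ⟨ l ⟩ᶜ is J{l/k}, with k being continuation index zero in J.
_⟨_⟩ᶜ : Exp s n (suc m) → Fin m → Exp s n m
_⟨_⟩ᶜ {m = m} J l = ren id κ J
  where
  κ : Fin (suc m) → Fin m
  κ zero    = l
  κ (suc k) = k

-- J ⟪ k ↦ M ⟫ is J{[k]□ ↦ [k](M where x := □)}, with x being index zero in M.
_⟪_↦_⟫ : Exp s n m → Fin m → Term (suc n) m → Exp s n m
var x         ⟪ k ↦ M ⟫ = var x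
(ƛ P)         ⟪ k ↦ M ⟫ = ƛ (P ⟪ k ↦ wk₁ M ⟫)
(P · Q)       ⟪ k ↦ M ⟫ = (P ⟪ k ↦ M ⟫) · (Q ⟪ k ↦ M ⟫)
(P where:= Q) ⟪ k ↦ M ⟫ = (P ⟪ k ↦ wk₁ M ⟫) where:= (Q ⟪ k ↦ M ⟫)
(μ J)         ⟪ k ↦ M ⟫ = μ (J ⟪ suc k ↦ wkᶜ M ⟫)
([ l ] Q)     ⟪ k ↦ M ⟫ with l ≟ k
... | yes _ = [ l ] (M where:= (Q ⟪ k ↦ M ⟫))
... | no  _ = [ l ] (Q ⟪ k ↦ M ⟫)

ExpRel : Set₁
ExpRel = ∀ {s n m} → Exp s n m → Exp s n m → Set

data Compat (R : ExpRel) : ExpRel where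
  base   : {P P′ : Exp s n m} → R P P′ → Compat R P P′
  ƛ_     : {M M′ : Term (suc n) m} → Compat R M M′ → Compat R (ƛ M) (ƛ M′)
  ·ˡ     : {M M′ N : Term n m} → Compat R M M′ → Compat R (M · N) (M′ · N)
  ·ʳ     : {M N N′ : Term n m} → Compat R N N′ → Compat R (M · N) (M · N′)
  whereˡ : {L L′ : Exp s (suc n) m} {M : Term n m} →
           Compat R L L′ → Compat R (L where:= M) (L′ where:= M)
  whereʳ : {L : Exp s (suc n) m} {M M′ : Term n m} →
           Compat R M M′ → Compat R (L where:= M) (L where:= M′)
  μ_     : {J J′ : Jump n (suc m)} → Compat R J J′ → Compat R (μ J) (μ J′)
  [_]_   : (k : Fin m) {M M′ : Term n m} →
           Compat R M M′ → Compat R ([ k ] M) ([ k ] M′)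

-- The smallest congruence containing R.
data Cong (R : ExpRel) : ExpRel where
  base  : {P P′ : Exp s n m} → R P P′ → Cong R P P′
  refl  : {P : Exp s n m} → Cong R P P
  sym   : {P Q : Exp s n m} → Cong R P Q → Cong R Q P
  trans : {P Q S : Exp s n m} → Cong R P Q → Cong R Q S → Cong R P S
  ƛ_    : {M M′ : Term (suc n) m} → Cong R M M′ → Cong R (ƛ M) (ƛ M′)
  _·_   : {M M′ N N′ : Term n m} →
          Cong R M M′ → Cong R N N′ → Cong R (M · N) (M′ · N′)
  _where:=_ : {L L′ : Exp s (suc n) m} {M M′ : Term n m} →
          Cong R L L′ → Cong R M M′ → Cong R (L where:= M) (L′ where:= M′)
  μ_    : {J J′ : Jump n (suc m)} → Cong R J J′ → Cong R (μ J) (μ J′)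
  [_]_  : (k : Fin m) {M M′ : Term n m} →
          Cong R M M′ → Cong R ([ k ] M) ([ k ] M′)

infix 4 _≐_ _≈_ _↦_ _⟶_ _⟶*_ _=ccv_

-- The version of E1 in which L is a jump is derivable, since by E3 every jump
-- is congruent to one of the form [ k ] M.
data _≐_ : ExpRel where
  E1 : (L M : Term (suc n) m) (N : Term n m) →
       L where:= (M where:= N) ≐ (wk₁ L where:= M) where:= N
  E2 : (J : Jump (suc n) (suc m)) (M : Term n m) →
       (μ J) where:= M ≐ μ (J where:= wkᶜ M)
  E3 : (k : Fin m) (L : Term (suc n) m) (M : Term n m) →
       [ k ] (L where:= M) ≐ ([ k ] L) where:= M

_≈_ : ExpRel
_≈_ = Cong _≐_

-- As for E1, the rules for where need only be given for terms.
data _↦_ : ExpRel where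
  ad₁ : {N M : Term n m} → NonValue N →
        N · M ↦ (var zero · wk M) where:= N
  ad₂ : {V N : Term n m} → Value V → NonValue N →
        V · N ↦ (wk V · var zero) where:= N
  βλ  : {M : Term (suc n) m} {V : Term n m} → Value V →
        (ƛ M) · V ↦ M where:= V
  βw  : {M : Term (suc n) m} {V : Term n m} → Value V →
        M where:= V ↦ M ⟨ V ⟩
  βμ  : {M : Term (suc n) m} {J : Jump n (suc m)} →
        M where:= (μ J) ↦ μ (J ⟪ zero ↦ wkᶜ M ⟫)
  βj  : {l : Fin m} {J : Jump n (suc m)} →
        [ l ] μ J ↦ J ⟨ l ⟩ᶜ
  ηλ  : {V : Term n m} → Value V →
        ƛ (wk V · var zero) ↦ V
  ηw  : {M : Term n m} →
        var zero where:= M ↦ M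
  ημ  : {M : Term n m} →
        μ [ zero ] wkᶜ M ↦ M

-- Expressions are identified up to _≈_: one-step reduction may choose
-- representatives on either side, and a reduction of length zero is _≈_.
_⟶_ : ExpRel
P ⟶ Q = ∃₂ λ P′ Q′ → P ≈ P′ × Compat _↦_ P′ Q′ × Q′ ≈ Q

data _⟶*_ : ExpRel where
  done : {P Q : Exp s n m} → P ≈ Q → P ⟶* Q
  step : {P Q S : Exp s n m} → P ⟶ Q → Q ⟶* S → P ⟶* S

_=ccv_ : ExpRel
_=ccv_ = Cong (λ P Q → P ≐ Q ⊎ P ↦ Q)

{-# OPTIONS --safe #-}
module Submission where

open import Data.Empty using (⊥; ⊥-elim)
open import Data.Fin using (Fin; zero; suc; lift; _≟_)
open import Data.Fin.Properties using (suc-injective)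
open import Data.List using (List; []; _∷_)
open import Data.Maybe using (Maybe; just; nothing) renaming (map to mapᴹ)
open import Data.Nat using (ℕ; zero; suc; _+_; _≤_; s≤s)
open import Data.Nat.Properties using (≤-refl; ≤-trans; ≤-reflexive; <⇒≤; m≤m+n; m≤n+m)
open import Data.Product using (∃-syntax; _×_; _,_; proj₁; proj₂; swap; map₂)
open import Data.Sum using (inj₁; inj₂)
open import Data.Unit using (⊤; tt)
open import Function using (id; _∘_)
open import Relation.Binary.Construct.Closure.ReflexiveTransitive using (Star; ε; _◅_; _◅◅_; gmap)
open import Relation.Binary.PropositionalEquality using (_≡_; _≢_; refl; sym; trans; cong; cong₂; subst; subst₂)
open import Relation.Nullary using (¬_; Dec; yes; no; contradiction)
open import Relation.Nullary.Decidable using (_×-dec_; ¬?)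
open import Defs renaming (refl to ≈-refl; sym to ≈-sym; trans to ≈-trans)

-- The CPS translation of M ends up in a βη-calculus with four kinds of terms:
-- values W, continuations K, computations T and answers Q.  It turns =ccv into
-- βη-equality, and βη is confluent.  An inverse translation carries βη-reductions
-- back to ⟶*, and M ⟶* inv (tr M), so a common reduct of the translations of M₁
-- and M₂ yields a common reduct of M₁ and M₂.
--
-- For M ⟶* inv (tr M) to hold in this direction, λk.A must not be inverted to
-- μ k. J when μ k. J is an ημ-redex, because reduction does not introduce such
-- redexes.  Therefore an answer is inverted to a jump in the form [ t ] M, which
-- E3 makes possible, and λk. [ t ] M to its ημ-contractum if it has one (see mu).

-- Confluence is moved to the target because reduction in the source works modulo E1 to E3 and its
-- rules depend on which operands are values; the target has neither a congruence nor side
-- conditions of that sort, and both sides of each equation become βη-equal there. The cost falls on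
-- the way back. A common reduct in the target need not be a translation, so the inverse is defined
-- on every term of the four kinds whose free variables have kind W or K, and every β- and η-step
-- between such terms is simulated.
--
-- The delicate point is that contracting ημ on the fly must survive further reduction. A contracted
-- μ k. [ k ] M leaves no jump for βj to act on, and whether k occurs may change during reduction.
-- Hence steps of a weakened term are shown to come from the term itself, and reduction of answers
-- is recorded by a relation that keeps the outermost continuation separate.

data Kind : Set where
  W K T Q : Kind

-- The rule (a , b , c) says that functions from a to b live in kind c.
data Rule : Kind → Kind → Kind → Set where
  rW : Rule W T W
  rK : Rule W Q K
  rT : Rule K Q T

Cx : Set
Cx = List Kind

private
  variable
    s s′ : Sort
    n n′ n″ m m′ m″ : ℕ
    Γ Δ Θ Ξ : Cx
    a b c u : Kind

-- Terms of the target calculus and their substitution laws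

data _∋_ : Cx → Kind → Set where
  ze : (a ∷ Γ) ∋ a
  su : ∀ {a b Γ} → Γ ∋ a → (b ∷ Γ) ∋ a

data Tm (Γ : Cx) : Kind → Set where
  var : Γ ∋ a → Tm Γ a
  lam : Rule a b c → Tm (a ∷ Γ) b → Tm Γ c
  app : Rule a b c → Tm Γ c → Tm Γ a → Tm Γ b

Renᵗ Subᵗ : Cx → Cx → Set
Renᵗ Γ Δ = ∀ {a} → Γ ∋ a → Δ ∋ a
Subᵗ Γ Δ = ∀ {a} → Γ ∋ a → Tm Δ a

extᵗ : Renᵗ Γ Δ → Renᵗ (u ∷ Γ) (u ∷ Δ)
extᵗ ρ ze     = ze
extᵗ ρ (su x) = su (ρ x)

renᵗ : Renᵗ Γ Δ → Tm Γ a → Tm Δ a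
renᵗ ρ (var x)     = var (ρ x)
renᵗ ρ (lam r M)   = lam r (renᵗ (extᵗ ρ) M)
renᵗ ρ (app r M N) = app r (renᵗ ρ M) (renᵗ ρ N)

wkᵗ : Tm Γ a → Tm (u ∷ Γ) a
wkᵗ = renᵗ su

extsᵗ : Subᵗ Γ Δ → Subᵗ (u ∷ Γ) (u ∷ Δ)
extsᵗ σ ze     = var ze
extsᵗ σ (su x) = wkᵗ (σ x)

subᵗ : Subᵗ Γ Δ → Tm Γ a → Tm Δ a
subᵗ σ (var x)     = σ x
subᵗ σ (lam r M)   = lam r (subᵗ (extsᵗ σ) M)
subᵗ σ (app r M N) = app r (subᵗ σ M) (subᵗ σ N)

inst : Tm Γ u → Subᵗ (u ∷ Γ) Γ
inst N ze     = N
inst N (su x) = var x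

infixl 8 _[_]

_[_] : Tm (u ∷ Γ) a → Tm Γ u → Tm Γ a
M [ N ] = subᵗ (inst N) M

-- The composite is a third map tied to the other two by a pointwise equation. This passes under
-- binders without function extensionality and lets one lemma serve every commuting square; the
-- fusion laws below have the same form.
renᵗ-renᵗ : {ρ : Renᵗ Γ Δ} {ρ′ : Renᵗ Δ Θ} {ρ″ : Renᵗ Γ Θ} →
            (∀ {a} (x : Γ ∋ a) → ρ′ (ρ x) ≡ ρ″ x) →
            (M : Tm Γ a) → renᵗ ρ′ (renᵗ ρ M) ≡ renᵗ ρ″ M
renᵗ-renᵗ e (var x)     = cong var (e x)
renᵗ-renᵗ e (lam r M)   = cong (lam r) (renᵗ-renᵗ (λ { ze → refl ; (su x) → cong su (e x) }) M)
renᵗ-renᵗ e (app r M N) = cong₂ (app r) (renᵗ-renᵗ e M) (renᵗ-renᵗ e N)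

subᵗ-renᵗ : {ρ : Renᵗ Γ Δ} {σ : Subᵗ Δ Θ} {τ : Subᵗ Γ Θ} →
            (∀ {a} (x : Γ ∋ a) → σ (ρ x) ≡ τ x) →
            (M : Tm Γ a) → subᵗ σ (renᵗ ρ M) ≡ subᵗ τ M
subᵗ-renᵗ e (var x)     = e x
subᵗ-renᵗ e (lam r M)   = cong (lam r) (subᵗ-renᵗ (λ { ze → refl ; (su x) → cong wkᵗ (e x) }) M)
subᵗ-renᵗ e (app r M N) = cong₂ (app r) (subᵗ-renᵗ e M) (subᵗ-renᵗ e N)

wkᵗ-renᵗ : {ρ : Renᵗ Γ Δ} (M : Tm Γ a) → renᵗ (extᵗ {u = u} ρ) (wkᵗ M) ≡ wkᵗ (renᵗ ρ M)
wkᵗ-renᵗ M = trans (renᵗ-renᵗ (λ _ → refl) M) (sym (renᵗ-renᵗ (λ _ → refl) M))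

renᵗ-subᵗ : {σ : Subᵗ Γ Δ} {ρ : Renᵗ Δ Θ} {τ : Subᵗ Γ Θ} →
            (∀ {a} (x : Γ ∋ a) → renᵗ ρ (σ x) ≡ τ x) →
            (M : Tm Γ a) → renᵗ ρ (subᵗ σ M) ≡ subᵗ τ M
renᵗ-subᵗ e (var x)     = e x
renᵗ-subᵗ {σ = σ} e (lam r M) = cong (lam r) (renᵗ-subᵗ
  (λ { ze → refl ; (su x) → trans (wkᵗ-renᵗ (σ x)) (cong wkᵗ (e x)) }) M)
renᵗ-subᵗ e (app r M N) = cong₂ (app r) (renᵗ-subᵗ e M) (renᵗ-subᵗ e N)

wkᵗ-subᵗ : {σ : Subᵗ Γ Δ} (M : Tm Γ a) → subᵗ (extsᵗ {u = u} σ) (wkᵗ M) ≡ wkᵗ (subᵗ σ M)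
wkᵗ-subᵗ M = trans (subᵗ-renᵗ (λ _ → refl) M) (sym (renᵗ-subᵗ (λ _ → refl) M))

subᵗ-subᵗ : {σ : Subᵗ Γ Δ} {σ′ : Subᵗ Δ Θ} {τ : Subᵗ Γ Θ} →
            (∀ {a} (x : Γ ∋ a) → subᵗ σ′ (σ x) ≡ τ x) →
            (M : Tm Γ a) → subᵗ σ′ (subᵗ σ M) ≡ subᵗ τ M
subᵗ-subᵗ e (var x)     = e x
subᵗ-subᵗ {σ = σ} e (lam r M) = cong (lam r) (subᵗ-subᵗ
  (λ { ze → refl ; (su x) → trans (wkᵗ-subᵗ (σ x)) (cong wkᵗ (e x)) }) M)
subᵗ-subᵗ e (app r M N) = cong₂ (app r) (subᵗ-subᵗ e M) (subᵗ-subᵗ e N)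

subᵗ-var : {ρ : Renᵗ Γ Δ} {σ : Subᵗ Γ Δ} → (∀ {a} (x : Γ ∋ a) → σ x ≡ var (ρ x)) →
           (M : Tm Γ a) → subᵗ σ M ≡ renᵗ ρ M
subᵗ-var e (var x)     = e x
subᵗ-var e (lam r M)   = cong (lam r) (subᵗ-var (λ { ze → refl ; (su x) → cong wkᵗ (e x) }) M)
subᵗ-var e (app r M N) = cong₂ (app r) (subᵗ-var e M) (subᵗ-var e N)

renᵗ-id : {ρ : Renᵗ Γ Γ} → (∀ {a} (x : Γ ∋ a) → ρ x ≡ x) → (M : Tm Γ a) → renᵗ ρ M ≡ M
renᵗ-id e (var x)     = cong var (e x)
renᵗ-id e (lam r M)   = cong (lam r) (renᵗ-id (λ { ze → refl ; (su x) → cong su (e x) }) M)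
renᵗ-id e (app r M N) = cong₂ (app r) (renᵗ-id e M) (renᵗ-id e N)

wkᵗ-[] : (M : Tm Γ a) {N : Tm Γ u} → wkᵗ M [ N ] ≡ M
wkᵗ-[] M = trans (subᵗ-renᵗ (λ _ → refl) M) (trans (subᵗ-var (λ _ → refl) M) (renᵗ-id (λ _ → refl) M))

renᵗ-[] : {ρ : Renᵗ Γ Δ} (M : Tm (u ∷ Γ) a) {N : Tm Γ u} →
          renᵗ ρ (M [ N ]) ≡ renᵗ (extᵗ ρ) M [ renᵗ ρ N ]
renᵗ-[] M = trans (renᵗ-subᵗ (λ _ → refl) M) (sym (subᵗ-renᵗ (λ { ze → refl ; (su x) → refl }) M))

subᵗ-[] : {σ : Subᵗ Γ Δ} (M : Tm (u ∷ Γ) a) {N : Tm Γ u} →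
          subᵗ σ (M [ N ]) ≡ subᵗ (extsᵗ σ) M [ subᵗ σ N ]
subᵗ-[] {σ = σ} M = trans (subᵗ-subᵗ (λ _ → refl) M)
  (sym (subᵗ-subᵗ (λ { ze → refl ; (su x) → wkᵗ-[] (σ x) }) M))

-- Serves the overlap in which `lam r (app r (wkᵗ (lam r B)) (var ze))` is contracted by β instead
-- of η: both give `lam r B`.
ext-su-[] : (M : Tm (u ∷ Γ) a) → renᵗ (extᵗ su) M [ var ze ] ≡ M
ext-su-[] M = trans (subᵗ-renᵗ {τ = var} (λ { ze → refl ; (su x) → refl }) M)
  (trans (subᵗ-var (λ _ → refl) M) (renᵗ-id (λ _ → refl) M))

-- Parallel reduction

infix 4 _⇛_ _⇛*_ _⟶ᵗ_ _⟶ᵗ*_ _≃_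

-- The equation in η keeps the left-hand side a pattern.
data _⇛_ {Γ} : Tm Γ a → Tm Γ a → Set where
  var : {x : Γ ∋ a} → var x ⇛ var x
  lam : {r : Rule a b c} {M M′ : Tm (a ∷ Γ) b} → M ⇛ M′ → lam r M ⇛ lam r M′
  app : {r : Rule a b c} {M M′ : Tm Γ c} {N N′ : Tm Γ a} →
        M ⇛ M′ → N ⇛ N′ → app r M N ⇛ app r M′ N′
  β   : {r : Rule a b c} {M M′ : Tm (a ∷ Γ) b} {N N′ : Tm Γ a} →
        M ⇛ M′ → N ⇛ N′ → app r (lam r M) N ⇛ M′ [ N′ ]
  η   : {r : Rule a b c} {X : Tm (a ∷ Γ) c} {M M′ : Tm Γ c} →
        wkᵗ M ≡ X → M ⇛ M′ → lam r (app r X (var ze)) ⇛ M′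

⇛-refl : (M : Tm Γ a) → M ⇛ M
⇛-refl (var x)     = var
⇛-refl (lam r M)   = lam (⇛-refl M)
⇛-refl (app r M N) = app (⇛-refl M) (⇛-refl N)

⇛-renᵗ : (ρ : Renᵗ Γ Δ) {M M′ : Tm Γ a} → M ⇛ M′ → renᵗ ρ M ⇛ renᵗ ρ M′
⇛-renᵗ ρ var       = var
⇛-renᵗ ρ (lam d)   = lam (⇛-renᵗ (extᵗ ρ) d)
⇛-renᵗ ρ (app d e) = app (⇛-renᵗ ρ d) (⇛-renᵗ ρ e)
⇛-renᵗ ρ (β {M′ = M′} d e) =
  subst (_ ⇛_) (sym (renᵗ-[] M′)) (β (⇛-renᵗ (extᵗ ρ) d) (⇛-renᵗ ρ e))
⇛-renᵗ ρ (η {M = M} refl d) = η (sym (wkᵗ-renᵗ M)) (⇛-renᵗ ρ d)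

⇛-subᵗ : {σ σ′ : Subᵗ Γ Δ} → (∀ {a} (x : Γ ∋ a) → σ x ⇛ σ′ x) →
         {M M′ : Tm Γ a} → M ⇛ M′ → subᵗ σ M ⇛ subᵗ σ′ M′
⇛-exts : {σ σ′ : Subᵗ Γ Δ} → (∀ {a} (x : Γ ∋ a) → σ x ⇛ σ′ x) →
         (x : (u ∷ Γ) ∋ a) → extsᵗ σ x ⇛ extsᵗ σ′ x
⇛-exts s ze     = var
⇛-exts s (su x) = ⇛-renᵗ su (s x)

⇛-subᵗ s (var {x = x}) = s x
⇛-subᵗ s (lam d)       = lam (⇛-subᵗ (⇛-exts s) d)
⇛-subᵗ s (app d e)     = app (⇛-subᵗ s d) (⇛-subᵗ s e)
⇛-subᵗ s (β {M′ = M′} d e) =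
  subst (_ ⇛_) (sym (subᵗ-[] M′)) (β (⇛-subᵗ (⇛-exts s) d) (⇛-subᵗ s e))
⇛-subᵗ s (η {M = M} refl d) = η (sym (wkᵗ-subᵗ M)) (⇛-subᵗ s d)

⇛-[] : {M M′ : Tm (u ∷ Γ) a} {N N′ : Tm Γ u} → M ⇛ M′ → N ⇛ N′ → M [ N ] ⇛ M′ [ N′ ]
⇛-[] d e = ⇛-subᵗ (λ { ze → e ; (su x) → var }) d

-- Pullbacks of renamings in the target calculus

-- The existence half of a pullback of variable maps. Extended to terms, it yields both the
-- injectivity of weakening and the fact that a term whose renaming is weakened was weakened
-- already.
Pullbackᵗ : Renᵗ Γ Ξ → Renᵗ Δ Ξ → Renᵗ Θ Γ → Renᵗ Θ Δ → Set
Pullbackᵗ {Γ} {Δ = Δ} {Θ = Θ} ρ₁ ρ₂ π₁ π₂ = ∀ {a} (x : Γ ∋ a) (y : Δ ∋ a) →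
  ρ₁ x ≡ ρ₂ y → ∃[ z ] (π₁ {a} z ≡ x × π₂ z ≡ y)

su-injective : {x y : Γ ∋ a} → su {b = b} x ≡ su y → x ≡ y
su-injective refl = refl

Pullbackᵗ-ext : {ρ₁ : Renᵗ Γ Ξ} {ρ₂ : Renᵗ Δ Ξ} {π₁ : Renᵗ Θ Γ} {π₂ : Renᵗ Θ Δ} →
  Pullbackᵗ ρ₁ ρ₂ π₁ π₂ →
  Pullbackᵗ (extᵗ {u = u} ρ₁) (extᵗ ρ₂) (extᵗ π₁) (extᵗ π₂)
Pullbackᵗ-ext p ze     ze     e = ze , refl , refl
Pullbackᵗ-ext p (su x) (su y) e with p x y (su-injective e)
... | z , refl , refl = su z , refl , refl

lam-injective : {r : Rule a b c} {M N : Tm (a ∷ Γ) b} → lam r M ≡ lam r N → M ≡ N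
lam-injective refl = refl

app-injective : {r : Rule a b c} {M M′ : Tm Γ c} {N N′ : Tm Γ a} →
                app r M N ≡ app r M′ N′ → M ≡ M′ × N ≡ N′
app-injective refl = refl , refl

pullbackᵗ : {ρ₁ : Renᵗ Γ Ξ} {ρ₂ : Renᵗ Δ Ξ} {π₁ : Renᵗ Θ Γ} {π₂ : Renᵗ Θ Δ} →
  Pullbackᵗ ρ₁ ρ₂ π₁ π₂ → (M : Tm Γ a) (N : Tm Δ a) → renᵗ ρ₁ M ≡ renᵗ ρ₂ N →
  ∃[ P ] (renᵗ π₁ P ≡ M × renᵗ π₂ P ≡ N)
pullbackᵗ p (var x) (var y) e with p x y (var-injective e)
  where
  var-injective : {x y : Γ ∋ a} → var x ≡ var y → x ≡ y
  var-injective refl = refl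
... | z , refl , refl = var z , refl , refl
-- The two terms carry independent rules; only a case split makes the binder kinds of both sides
-- agree.
pullbackᵗ p (lam rW M) (lam rW N) e with pullbackᵗ (Pullbackᵗ-ext p) M N (lam-injective e)
... | P , refl , refl = lam rW P , refl , refl
pullbackᵗ p (lam rK M) (lam rK N) e with pullbackᵗ (Pullbackᵗ-ext p) M N (lam-injective e)
... | P , refl , refl = lam rK P , refl , refl
pullbackᵗ p (lam rT M) (lam rT N) e with pullbackᵗ (Pullbackᵗ-ext p) M N (lam-injective e)
... | P , refl , refl = lam rT P , refl , refl
pullbackᵗ p (app rW M M′) (app rW N N′) e with app-injective e
... | e₁ , e₂ with pullbackᵗ p M N e₁ | pullbackᵗ p M′ N′ e₂
... | P , refl , refl | P′ , refl , refl = app rW P P′ , refl , refl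
pullbackᵗ p (app rK M M′) (app rK N N′) e with app-injective e
... | e₁ , e₂ with pullbackᵗ p M N e₁ | pullbackᵗ p M′ N′ e₂
... | P , refl , refl | P′ , refl , refl = app rK P P′ , refl , refl
pullbackᵗ p (app rT M M′) (app rT N N′) e with app-injective e
... | e₁ , e₂ with pullbackᵗ p M N e₁ | pullbackᵗ p M′ N′ e₂
... | P , refl , refl | P′ , refl , refl = app rT P P′ , refl , refl

wkᵗ-injective : (M N : Tm Γ a) → wkᵗ {u = u} M ≡ wkᵗ N → M ≡ N
wkᵗ-injective M N e with pullbackᵗ {π₁ = λ x → x} {π₂ = λ x → x} (λ { x y refl → x , refl , refl }) M N e
... | P , p , q = trans (sym p) q

wkᵗ-pullback : {ρ : Renᵗ Γ Δ} (X : Tm (u ∷ Γ) a) (M : Tm Δ a) → renᵗ (extᵗ ρ) X ≡ wkᵗ M →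
               ∃[ M₀ ] (wkᵗ M₀ ≡ X × renᵗ ρ M₀ ≡ M)
wkᵗ-pullback X M = pullbackᵗ (λ { ze y () ; (su x) y e → x , refl , su-injective e }) X M

-- Reduction creates no variables, so a reduct of a weakened term is weakened, which the η overlaps
-- need. Injectivity of `ρ` is not at issue: `extᵗ ρ` sends only the bound variable to `ze`, so an
-- η-redex after renaming was one before.
⇛-unrenᵗ : (ρ : Renᵗ Γ Δ) {P N : Tm Δ a} → P ⇛ N → (M : Tm Γ a) → renᵗ ρ M ≡ P →
           ∃[ N₀ ] (renᵗ ρ N₀ ≡ N × M ⇛ N₀)
⇛-unrenᵗ ρ var (var x) refl = var x , refl , var
⇛-unrenᵗ ρ (lam d) (lam r M) refl with ⇛-unrenᵗ (extᵗ ρ) d M refl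
... | N , refl , d₀ = lam r N , refl , lam d₀
⇛-unrenᵗ ρ (app d e) (app r M N) refl with ⇛-unrenᵗ ρ d M refl | ⇛-unrenᵗ ρ e N refl
... | M₀ , refl , d₀ | N₀ , refl , e₀ = app r M₀ N₀ , refl , app d₀ e₀
⇛-unrenᵗ ρ (β d e) (app r (lam .r M) N) refl with ⇛-unrenᵗ (extᵗ ρ) d M refl | ⇛-unrenᵗ ρ e N refl
... | M₀ , refl , d₀ | N₀ , refl , e₀ = M₀ [ N₀ ] , renᵗ-[] M₀ , β d₀ e₀
⇛-unrenᵗ ρ (η {M = M} e d) (lam r (app .r X (var ze))) refl with wkᵗ-pullback X M (sym e)
... | M₀ , e₀ , refl with ⇛-unrenᵗ ρ d M₀ refl
... | N₀ , refl , d₀ = N₀ , refl , η e₀ d₀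

-- The diamond property and confluence

size : Tm Γ a → ℕ
size (var x)     = 0
size (lam r M)   = suc (size M)
size (app r M N) = suc (size M + size N)

size-renᵗ : (ρ : Renᵗ Γ Δ) (M : Tm Γ a) → size (renᵗ ρ M) ≡ size M
size-renᵗ ρ (var x)     = refl
size-renᵗ ρ (lam r M)   = cong suc (size-renᵗ (extᵗ ρ) M)
size-renᵗ ρ (app r M N) = cong suc (cong₂ _+_ (size-renᵗ ρ M) (size-renᵗ ρ N))

Join⇛ : Tm Γ a → Tm Γ a → Set
Join⇛ N₁ N₂ = ∃[ P ] (N₁ ⇛ P × N₂ ⇛ P)

-- In an η-redex the subterm is `wkᵗ M`, while the induction hypothesis is wanted for `M`, which is
-- not a subterm. Size is invariant under renaming and covers this case.
Diamond≤ : ℕ → Set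
Diamond≤ n = ∀ {Γ a} {M N₁ N₂ : Tm Γ a} → size M ≤ n → M ⇛ N₁ → M ⇛ N₂ → Join⇛ N₁ N₂

-- Overlap of η with a step of the body. Either the step takes place in the weakened term, and the
-- η-redex is still there, or that term is an abstraction consumed by β, which by `ext-su-[]` has
-- the effect of η.
diamond-lam-η : ∀ {n} → Diamond≤ n → {r : Rule a b c} {X : Tm (a ∷ Γ) c} {M : Tm Γ c} →
  size X ≤ n → wkᵗ M ≡ X →
  {N₁ : Tm (a ∷ Γ) b} {N₂ : Tm Γ c} → app r X (var ze) ⇛ N₁ → M ⇛ N₂ → Join⇛ (lam r N₁) N₂
diamond-lam-η ih {M = M} s e (app d var) f with ⇛-unrenᵗ su d M e
... | M₁ , refl , d₁ with ih (≤-trans (≤-reflexive (trans (sym (size-renᵗ su M)) (cong size e))) s) d₁ f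
... | P , p , q = P , η refl p , q
diamond-lam-η ih {M = lam r B} s refl (β d var) f with ⇛-unrenᵗ (extᵗ su) d B refl
... | B₁ , refl , d₁ with ih (≤-trans (≤-reflexive (sym (size-renᵗ su (lam r B)))) s) (lam d₁) f
... | P , p , q = P , subst (λ z → lam _ z ⇛ P) (sym (ext-su-[] B₁)) p , q

-- Overlap of β with steps in function and argument. If the function is contracted by η, its body is
-- `app r (wkᵗ _) (var ze)`; the step is replayed inside that body, where the induction hypothesis
-- applies, and instantiation gives back the application.
diamond-β-app : ∀ {n} → Diamond≤ n → {r : Rule a b c} {M N₁ : Tm (a ∷ Γ) b} {N N′ N″ : Tm Γ a} {F : Tm Γ c} →
  size M ≤ n → size N ≤ n → M ⇛ N₁ → N ⇛ N′ → lam r M ⇛ F → N ⇛ N″ →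
  Join⇛ (N₁ [ N′ ]) (app r F N″)
diamond-β-app ih sM sN d e (lam f) g with ih sM d f | ih sN e g
... | P , p₁ , p₂ | R , q₁ , q₂ = P [ R ] , ⇛-[] p₁ q₁ , β p₂ q₂
diamond-β-app ih {N″ = N″} sM sN d e (η {M′ = M′} refl f) g
  with ih sM d (app (⇛-renᵗ su f) var) | ih sN e g
... | P , p₁ , p₂ | R , q₁ , q₂ = P [ R ] , ⇛-[] p₁ q₁ ,
  subst (λ z → app _ z N″ ⇛ P [ R ]) (wkᵗ-[] M′) (⇛-[] p₂ q₂)

private
  left : ∀ {i j k} → suc (i + j) ≤ k → i ≤ k
  left s = ≤-trans (m≤m+n _ _) (<⇒≤ s)

  right : ∀ {i j k} → suc (i + j) ≤ k → j ≤ k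
  right {i} s = ≤-trans (m≤n+m _ i) (<⇒≤ s)

diamond : ∀ n → Diamond≤ n
diamond n s var var = _ , var , var
diamond (suc n) (s≤s s) (lam d) (lam e) with diamond n s d e
... | P , p , q = lam _ P , lam p , lam q
diamond (suc n) (s≤s s) (lam d) (η e f) =
  diamond-lam-η (diamond n) (left s) e d f
diamond (suc n) (s≤s s) (η e f) (lam d) =
  map₂ swap (diamond-lam-η (diamond n) (left s) e d f)
diamond (suc n) (s≤s s) (η {M = M} refl d) (η {M = M₂} e′ f)
  with refl ← wkᵗ-injective M₂ M e′ =
  diamond n (≤-trans (≤-reflexive (sym (size-renᵗ su M))) (left s)) d f
diamond (suc n) (s≤s s) (app d e) (app f g)
  with diamond n (≤-trans (m≤m+n _ _) s) d f | diamond n (≤-trans (m≤n+m _ _) s) e g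
... | P , p₁ , p₂ | R , q₁ , q₂ = app _ P R , app p₁ q₁ , app p₂ q₂
diamond (suc n) (s≤s s) (β d e) (β f g)
  with diamond n (left s) d f | diamond n (right s) e g
... | P , p₁ , p₂ | R , q₁ , q₂ = P [ R ] , ⇛-[] p₁ q₁ , ⇛-[] p₂ q₂
diamond (suc n) (s≤s s) (β d e) (app f g) =
  diamond-β-app (diamond n) (left s)
    (right s) d e f g
diamond (suc n) (s≤s s) (app f g) (β d e) = map₂ swap (diamond-β-app (diamond n) (left s) (right s) d e f g)

_⇛*_ : Tm Γ a → Tm Γ a → Set
_⇛*_ = Star _⇛_

strip : {M N₁ N₂ : Tm Γ a} → M ⇛ N₁ → M ⇛* N₂ → ∃[ P ] (N₁ ⇛* P × N₂ ⇛ P)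
strip d ε = _ , ε , d
strip d (e ◅ es) with diamond _ ≤-refl d e
... | P , p , q with strip q es
... | R , r , s = R , p ◅ r , s

confluent : {M N₁ N₂ : Tm Γ a} → M ⇛* N₁ → M ⇛* N₂ → ∃[ P ] (N₁ ⇛* P × N₂ ⇛* P)
confluent ε es = _ , es , ε
confluent (d ◅ ds) es with strip d es
... | P , p , q with confluent ds p
... | R , r , s = R , r , q ◅ s

-- By confluence, βη-equality is joinability.
_≃_ : Tm Γ a → Tm Γ a → Set
M ≃ N = ∃[ P ] (M ⇛* P × N ⇛* P)

≃-refl : {M : Tm Γ a} → M ≃ M
≃-refl = _ , ε , ε

≃-sym : {M N : Tm Γ a} → M ≃ N → N ≃ M
≃-sym (P , p , q) = P , q , p

≃-trans : {M N P : Tm Γ a} → M ≃ N → N ≃ P → M ≃ P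
≃-trans (A , p , q) (B , r , s) with confluent q r
... | C , t , u = C , p ◅◅ t , s ◅◅ u

≃-reflexive : {M N : Tm Γ a} → M ≡ N → M ≃ N
≃-reflexive refl = ≃-refl

≃-lam : {r : Rule a b c} {M N : Tm (a ∷ Γ) b} → M ≃ N → lam r M ≃ lam r N
≃-lam (P , p , q) = lam _ P , gmap (lam _) lam p , gmap (lam _) lam q

⇛*-app : {r : Rule a b c} {M M′ : Tm Γ c} {N N′ : Tm Γ a} →
         M ⇛* M′ → N ⇛* N′ → app r M N ⇛* app r M′ N′
⇛*-app p q = gmap (λ z → app _ z _) (λ d → app d (⇛-refl _)) p ◅◅
             gmap (app _ _) (app (⇛-refl _)) q

≃-app : {r : Rule a b c} {M M′ : Tm Γ c} {N N′ : Tm Γ a} →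
        M ≃ M′ → N ≃ N′ → app r M N ≃ app r M′ N′
≃-app (P , p , q) (R , s , t) = app _ P R , ⇛*-app p s , ⇛*-app q t

≃-renᵗ : (ρ : Renᵗ Γ Δ) {M N : Tm Γ a} → M ≃ N → renᵗ ρ M ≃ renᵗ ρ N
≃-renᵗ ρ (P , p , q) = renᵗ ρ P , gmap (renᵗ ρ) (⇛-renᵗ ρ) p , gmap (renᵗ ρ) (⇛-renᵗ ρ) q

≃-β : {r : Rule a b c} (M : Tm (a ∷ Γ) b) (N : Tm Γ a) → app r (lam r M) N ≃ M [ N ]
≃-β M N = _ , β (⇛-refl M) (⇛-refl N) ◅ ε , ε

≃-η : {r : Rule a b c} (M : Tm Γ c) → lam r (app r (wkᵗ M) (var ze)) ≃ M
≃-η M = _ , η refl (⇛-refl M) ◅ ε , ε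

-- Parallel steps suit confluence; the simulation by `inv` is easier with one redex at a time.
data _⟶ᵗ_ {Γ} : Tm Γ a → Tm Γ a → Set where
  lam  : {r : Rule a b c} {M M′ : Tm (a ∷ Γ) b} → M ⟶ᵗ M′ → lam r M ⟶ᵗ lam r M′
  appˡ : {r : Rule a b c} {M M′ : Tm Γ c} {N : Tm Γ a} → M ⟶ᵗ M′ → app r M N ⟶ᵗ app r M′ N
  appʳ : {r : Rule a b c} {M : Tm Γ c} {N N′ : Tm Γ a} → N ⟶ᵗ N′ → app r M N ⟶ᵗ app r M N′
  β    : {r : Rule a b c} (M : Tm (a ∷ Γ) b) (N : Tm Γ a) → app r (lam r M) N ⟶ᵗ M [ N ]
  η    : (r : Rule a b c) (M : Tm Γ c) → lam r (app r (wkᵗ M) (var ze)) ⟶ᵗ M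

_⟶ᵗ*_ : Tm Γ a → Tm Γ a → Set
_⟶ᵗ*_ = Star _⟶ᵗ_

⟶ᵗ*-app : {r : Rule a b c} {M M′ : Tm Γ c} {N N′ : Tm Γ a} →
          M ⟶ᵗ* M′ → N ⟶ᵗ* N′ → app r M N ⟶ᵗ* app r M′ N′
⟶ᵗ*-app p q = gmap (λ z → app _ z _) appˡ p ◅◅ gmap (app _ _) appʳ q

⇛⇒⟶ᵗ* : {M N : Tm Γ a} → M ⇛ N → M ⟶ᵗ* N
⇛⇒⟶ᵗ* var       = ε
⇛⇒⟶ᵗ* (lam d)   = gmap (lam _) lam (⇛⇒⟶ᵗ* d)
⇛⇒⟶ᵗ* (app d e) = ⟶ᵗ*-app (⇛⇒⟶ᵗ* d) (⇛⇒⟶ᵗ* e)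
⇛⇒⟶ᵗ* (β d e)   = ⟶ᵗ*-app (gmap (lam _) lam (⇛⇒⟶ᵗ* d)) (⇛⇒⟶ᵗ* e) ◅◅ β _ _ ◅ ε
⇛⇒⟶ᵗ* (η {M = M} refl d) = η _ M ◅ ⇛⇒⟶ᵗ* d

-- Renaming and substitution laws of the source calculus

lift-∘ : {f : Fin n → Fin n′} {g : Fin n′ → Fin n″} {h : Fin n → Fin n″} →
         (∀ x → g (f x) ≡ h x) → ∀ x → lift 1 g (lift 1 f x) ≡ lift 1 h x
lift-∘ e zero    = refl
lift-∘ e (suc x) = cong suc (e x)

lift-id : {f : Fin n → Fin n} → (∀ x → f x ≡ x) → ∀ x → lift 1 f x ≡ x
lift-id e zero    = refl
lift-id e (suc x) = cong suc (e x)

ren-ren : {ρ : Fin n → Fin n′} {ρ′ : Fin n′ → Fin n″} {ρ″ : Fin n → Fin n″}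
          {κ : Fin m → Fin m′} {κ′ : Fin m′ → Fin m″} {κ″ : Fin m → Fin m″} →
          (∀ x → ρ′ (ρ x) ≡ ρ″ x) → (∀ k → κ′ (κ k) ≡ κ″ k) →
          (M : Exp s n m) → ren ρ′ κ′ (ren ρ κ M) ≡ ren ρ″ κ″ M
ren-ren e f (var x)       = cong var (e x)
ren-ren e f (ƛ M)         = cong ƛ_ (ren-ren (lift-∘ e) f M)
ren-ren e f (M · N)       = cong₂ _·_ (ren-ren e f M) (ren-ren e f N)
ren-ren e f (L where:= M) = cong₂ _where:=_ (ren-ren (lift-∘ e) f L) (ren-ren e f M)
ren-ren e f (μ J)         = cong μ_ (ren-ren e (lift-∘ f) J)
ren-ren e f ([ k ] M)     = cong₂ [_]_ (f k) (ren-ren e f M)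

ren-id : {ρ : Fin n → Fin n} {κ : Fin m → Fin m} → (∀ x → ρ x ≡ x) → (∀ k → κ k ≡ k) →
         (M : Exp s n m) → ren ρ κ M ≡ M
ren-id e f (var x)       = cong var (e x)
ren-id e f (ƛ M)         = cong ƛ_ (ren-id (lift-id e) f M)
ren-id e f (M · N)       = cong₂ _·_ (ren-id e f M) (ren-id e f N)
ren-id e f (L where:= M) = cong₂ _where:=_ (ren-id (lift-id e) f L) (ren-id e f M)
ren-id e f (μ J)         = cong μ_ (ren-id e (lift-id f) J)
ren-id e f ([ k ] M)     = cong₂ [_]_ (f k) (ren-id e f M)

ren-cong : {ρ ρ′ : Fin n → Fin n′} {κ κ′ : Fin m → Fin m′} →
           (∀ x → ρ x ≡ ρ′ x) → (∀ k → κ k ≡ κ′ k) →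
           (M : Exp s n m) → ren ρ κ M ≡ ren ρ′ κ′ M
ren-cong {ρ = ρ} {κ = κ} e f M =
  trans (cong (ren ρ κ) (sym (ren-id (λ _ → refl) (λ _ → refl) M))) (ren-ren e f M)

ren-square : ∀ {n‴ m‴} {ρ : Fin n → Fin n′} {ρ′ : Fin n′ → Fin n″}
             {σ : Fin n → Fin n‴} {σ′ : Fin n‴ → Fin n″}
             {κ : Fin m → Fin m′} {κ′ : Fin m′ → Fin m″} {τ : Fin m → Fin m‴} {τ′ : Fin m‴ → Fin m″} →
             (∀ x → ρ′ (ρ x) ≡ σ′ (σ x)) → (∀ k → κ′ (κ k) ≡ τ′ (τ k)) →
             (M : Exp s n m) → ren ρ′ κ′ (ren ρ κ M) ≡ ren σ′ τ′ (ren σ τ M)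
ren-square e f M = trans (ren-ren e f M) (sym (ren-ren (λ _ → refl) (λ _ → refl) M))

ren-wk : {ρ : Fin n → Fin n′} {κ : Fin m → Fin m′} (M : Exp s n m) →
         ren (lift 1 ρ) κ (wk M) ≡ wk (ren ρ κ M)
ren-wk = ren-square (λ _ → refl) (λ _ → refl)

ren-wkᶜ : {ρ : Fin n → Fin n′} {κ : Fin m → Fin m′} (M : Exp s n m) →
          ren ρ (lift 1 κ) (wkᶜ M) ≡ wkᶜ (ren ρ κ M)
ren-wkᶜ = ren-square (λ _ → refl) (λ _ → refl)

ren-wk₁ : {ρ : Fin n → Fin n′} {κ : Fin m → Fin m′} (M : Exp s (suc n) m) →
          ren (lift 1 (lift 1 ρ)) κ (wk₁ M) ≡ wk₁ (ren (lift 1 ρ) κ M)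
ren-wk₁ = ren-square (λ { zero → refl ; (suc x) → refl }) (λ _ → refl)

ren-sub : {ρ : Fin n → Fin n′} {κ : Fin m → Fin m′} {l : ℕ} {ρ″ : Fin l → Fin n″}
          {σ : Fin l → Term n m} {τ : Fin n″ → Term n′ m′} →
          (∀ x → ren ρ κ (σ x) ≡ τ (ρ″ x)) →
          (M : Exp s l m) → ren ρ κ (sub σ M) ≡ sub τ (ren ρ″ κ M)
ren-sub-exts : {ρ : Fin n → Fin n′} {κ : Fin m → Fin m′} {l : ℕ} {ρ″ : Fin l → Fin n″}
          {σ : Fin l → Term n m} {τ : Fin n″ → Term n′ m′} →
          (∀ x → ren ρ κ (σ x) ≡ τ (ρ″ x)) →
          ∀ x → ren (lift 1 ρ) κ (exts σ x) ≡ exts τ (lift 1 ρ″ x)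
ren-sub-exts e zero    = refl
ren-sub-exts {σ = σ} e (suc x) = trans (ren-wk (σ x)) (cong wk (e x))
ren-sub e (var x)       = e x
ren-sub e (ƛ M) = cong ƛ_ (ren-sub (ren-sub-exts e) M)
ren-sub e (M · N)       = cong₂ _·_ (ren-sub e M) (ren-sub e N)
ren-sub e (L where:= M) = cong₂ _where:=_ (ren-sub (ren-sub-exts e) L) (ren-sub e M)
ren-sub {σ = σ} e (μ J) =
  cong μ_ (ren-sub (λ x → trans (ren-wkᶜ (σ x)) (cong wkᶜ (e x))) J)
ren-sub e ([ k ] M)     = cong ([ _ ]_) (ren-sub e M)

ren-⟨⟩ : {ρ : Fin n → Fin n′} {κ : Fin m → Fin m′} (M : Exp s (suc n) m) (V : Term n m) →
         ren ρ κ (M ⟨ V ⟩) ≡ ren (lift 1 ρ) κ M ⟨ ren ρ κ V ⟩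
ren-⟨⟩ M V = ren-sub (λ { zero → refl ; (suc x) → refl }) M

ren-⟨⟩ᶜ : {ρ : Fin n → Fin n′} {κ : Fin m → Fin m′} (J : Exp s n (suc m)) (l : Fin m) →
          ren ρ κ (J ⟨ l ⟩ᶜ) ≡ ren ρ (lift 1 κ) J ⟨ κ l ⟩ᶜ
ren-⟨⟩ᶜ J l = ren-square (λ _ → refl) (λ { zero → refl ; (suc x) → refl }) J

-- The hypothesis keeps other continuation variables from being renamed to `κ k`; the replacement
-- after renaming would otherwise reach jumps that it did not reach before.
ren-⟪⟫ : {ρ : Fin n → Fin n′} {κ : Fin m → Fin m′} {k : Fin m} → (∀ l → κ l ≡ κ k → l ≡ k) →
         (P : Exp s n m) (M : Term (suc n) m) →
         ren ρ κ (P ⟪ k ↦ M ⟫) ≡ ren ρ κ P ⟪ κ k ↦ ren (lift 1 ρ) κ M ⟫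
ren-⟪⟫ i (var x)       M = refl
ren-⟪⟫ {ρ = ρ} {κ} {k} i (ƛ P) M =
  cong ƛ_ (trans (ren-⟪⟫ i P (wk₁ M)) (cong (ren (lift 1 ρ) κ P ⟪ κ k ↦_⟫) (ren-wk₁ M)))
ren-⟪⟫ i (P · P′)      M = cong₂ _·_ (ren-⟪⟫ i P M) (ren-⟪⟫ i P′ M)
ren-⟪⟫ {ρ = ρ} {κ} {k} i (P where:= R) M = cong₂ _where:=_
  (trans (ren-⟪⟫ i P (wk₁ M)) (cong (ren (lift 1 ρ) κ P ⟪ κ k ↦_⟫) (ren-wk₁ M))) (ren-⟪⟫ i R M)
ren-⟪⟫ {ρ = ρ} {κ} {k} i (μ J) M = cong μ_ (trans
  (ren-⟪⟫ (λ { zero () ; (suc l) e → cong suc (i l (suc-injective e)) }) J (wkᶜ M))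
  (cong (ren ρ (lift 1 κ) J ⟪ suc (κ k) ↦_⟫) (ren-wkᶜ M)))
ren-⟪⟫ {κ = κ} {k = k} i ([ l ] R) M with l ≟ k | κ l ≟ κ k
... | yes _ | yes _ = cong (λ z → [ _ ] (_ where:= z)) (ren-⟪⟫ i R M)
... | yes e | no ¬e = contradiction (cong κ e) ¬e
... | no ¬e | yes e = contradiction (i l e) ¬e
... | no _  | no _  = cong ([ _ ]_) (ren-⟪⟫ i R M)

-- Absence of continuation variables

infix 4 _∉_ _∉?_

-- A decidable counterpart of being in the image of `wkᶜ`, as `mu` has to test for an ημ-redex.
-- `zero∉wkᶜ` and `strengthenᶜ` connect the two.
_∉_ : Fin m → Exp s n m → Set
k ∉ var x         = ⊤
k ∉ (ƛ M)         = k ∉ M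
k ∉ (M · N)       = k ∉ M × k ∉ N
k ∉ (L where:= M) = k ∉ L × k ∉ M
k ∉ (μ J)         = suc k ∉ J
k ∉ ([ l ] M)     = l ≢ k × k ∉ M

_∉?_ : (k : Fin m) (M : Exp s n m) → Dec (k ∉ M)
k ∉? var x         = yes tt
k ∉? (ƛ M)         = k ∉? M
k ∉? (M · N)       = (k ∉? M) ×-dec (k ∉? N)
k ∉? (L where:= M) = (k ∉? L) ×-dec (k ∉? M)
k ∉? (μ J)         = suc k ∉? J
k ∉? ([ l ] M)     = ¬? (l ≟ k) ×-dec (k ∉? M)

∉-ren : {ρ : Fin n → Fin n′} {κ : Fin m → Fin m′} {k : Fin m} {k′ : Fin m′} →
        (∀ l → κ l ≡ k′ → l ≡ k) → (M : Exp s n m) → k ∉ M → k′ ∉ ren ρ κ M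
∉-ren i (var x)       p       = tt
∉-ren i (ƛ M)         p       = ∉-ren i M p
∉-ren i (M · N)       (p , q) = ∉-ren i M p , ∉-ren i N q
∉-ren i (L where:= M) (p , q) = ∉-ren i L p , ∉-ren i M q
∉-ren i (μ J)         p       = ∉-ren (λ { zero () ; (suc l) e → cong suc (i l (suc-injective e)) }) J p
∉-ren i ([ l ] M)     (p , q) = (λ e → p (i l e)) , ∉-ren i M q

∉-unren : {ρ : Fin n → Fin n′} {κ : Fin m → Fin m′} {k : Fin m} {k′ : Fin m′} →
          κ k ≡ k′ → (M : Exp s n m) → k′ ∉ ren ρ κ M → k ∉ M
∉-unren i (var x)       p       = tt
∉-unren i (ƛ M)         p       = ∉-unren i M p
∉-unren i (M · N)       (p , q) = ∉-unren i M p , ∉-unren i N q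
∉-unren i (L where:= M) (p , q) = ∉-unren i L p , ∉-unren i M q
∉-unren i (μ J)         p       = ∉-unren (cong suc i) J p
∉-unren {κ = κ} i ([ l ] M) (p , q) = (λ e → p (trans (cong κ e) i)) , ∉-unren i M q

zero∉wkᶜ : (M : Exp s n m) → zero ∉ wkᶜ M
zero∉wkᶜ M = go (λ _ ()) M
  where
  go : {ρ : Fin n → Fin n′} {κ : Fin m → Fin m′} {k : Fin m′} →
       (∀ l → κ l ≢ k) → (M : Exp s n m) → k ∉ ren ρ κ M
  go i (var x)       = tt
  go i (ƛ M)         = go i M
  go i (M · N)       = go i M , go i N
  go i (L where:= M) = go i L , go i M
  go i (μ J)         = go (λ { zero () ; (suc l) e → i l (suc-injective e) }) J
  go i ([ l ] M)     = i l , go i M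

∉-sub : {σ : Fin n → Term n′ m} {k : Fin m} → (M : Exp s n m) → k ∉ sub σ M → k ∉ M
∉-sub (var x)       p       = tt
∉-sub (ƛ M)         p       = ∉-sub M p
∉-sub (M · N)       (p , q) = ∉-sub M p , ∉-sub N q
∉-sub (L where:= M) (p , q) = ∉-sub L p , ∉-sub M q
∉-sub (μ J)         p       = ∉-sub J p
∉-sub ([ l ] M)     (p , q) = p , ∉-sub M q

∉-⟪⟫ : {j k : Fin m} (P : Exp s n m) {M : Term (suc n) m} → k ∉ (P ⟪ j ↦ M ⟫) → k ∉ P
∉-⟪⟫ (var x)       p       = tt
∉-⟪⟫ (ƛ M)         p       = ∉-⟪⟫ M p
∉-⟪⟫ (M · N)       (p , q) = ∉-⟪⟫ M p , ∉-⟪⟫ N q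
∉-⟪⟫ (L where:= M) (p , q) = ∉-⟪⟫ L p , ∉-⟪⟫ M q
∉-⟪⟫ (μ J)         p       = ∉-⟪⟫ J p
∉-⟪⟫ {j = j} ([ l ] M) p with l ≟ j
... | yes _ = proj₁ p , ∉-⟪⟫ M (proj₂ (proj₂ p))
... | no _  = proj₁ p , ∉-⟪⟫ M (proj₂ p)

⟪⟫-∉ : {k : Fin m} (P : Exp s n m) {M : Term (suc n) m} → k ∉ P → P ⟪ k ↦ M ⟫ ≡ P
⟪⟫-∉ (var x)       p       = refl
⟪⟫-∉ (ƛ M)         p       = cong ƛ_ (⟪⟫-∉ M p)
⟪⟫-∉ (M · N)       (p , q) = cong₂ _·_ (⟪⟫-∉ M p) (⟪⟫-∉ N q)
⟪⟫-∉ (L where:= M) (p , q) = cong₂ _where:=_ (⟪⟫-∉ L p) (⟪⟫-∉ M q)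
⟪⟫-∉ (μ J)         p       = cong μ_ (⟪⟫-∉ J p)
⟪⟫-∉ {k = k} ([ l ] M) (p , q) with l ≟ k
... | yes e = contradiction e p
... | no _  = cong ([ l ]_) (⟪⟫-∉ M q)

lift-surjective : {f : Fin n → Fin n′} → (∀ x → ∃[ y ] f y ≡ x) → ∀ x → ∃[ y ] lift 1 f y ≡ x
lift-surjective h zero    = zero , refl
lift-surjective h (suc x) = suc (proj₁ (h x)) , cong suc (proj₂ (h x))

lift-covers : {f : Fin m → Fin m′} {k : Fin m′} → (∀ l → l ≢ k → ∃[ j ] f j ≡ l) →
              ∀ l → l ≢ suc k → ∃[ j ] lift 1 f j ≡ l
lift-covers h zero    e = zero , refl
lift-covers h (suc l) e = let j , q = h l (e ∘ cong suc) in suc j , cong suc q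

-- Stated for maps that are onto, respectively onto all variables but `k`, because both properties
-- survive `lift 1` while the shape of `wkᶜ` does not.
strengthen : {ρ : Fin n → Fin n′} {κ : Fin m → Fin m′} {k : Fin m′} →
             (∀ x → ∃[ y ] ρ y ≡ x) → (∀ l → l ≢ k → ∃[ j ] κ j ≡ l) →
             (M : Exp s n′ m′) → k ∉ M → ∃[ M₀ ] ren ρ κ M₀ ≡ M
strengthen f g (var x) p with f x
... | y , refl = var y , refl
strengthen f g (ƛ M) p with strengthen (lift-surjective f) g M p
... | M₀ , refl = ƛ M₀ , refl
strengthen f g (M · N) (p , q) with strengthen f g M p | strengthen f g N q
... | M₀ , refl | N₀ , refl = M₀ · N₀ , refl
strengthen f g (L where:= M) (p , q) with strengthen (lift-surjective f) g L p | strengthen f g M q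
... | L₀ , refl | M₀ , refl = (L₀ where:= M₀) , refl
strengthen f g (μ J) p with strengthen f (lift-covers g) J p
... | J₀ , refl = μ J₀ , refl
strengthen f g ([ l ] M) (p , q) with g l p | strengthen f g M q
... | j , refl | M₀ , refl = [ j ] M₀ , refl

strengthenᶜ : (M : Exp s n (suc m)) → zero ∉ M → ∃[ M₀ ] wkᶜ M₀ ≡ M
strengthenᶜ = strengthen (λ x → x , refl) (λ { zero e → contradiction refl e ; (suc l) _ → l , refl })

-- Pullbacks of renamings

Pullback : ∀ {p} → (Fin n → Fin n″) → (Fin n′ → Fin n″) → (Fin p → Fin n) → (Fin p → Fin n′) → Set
Pullback {p = p} f₁ f₂ π₁ π₂ = ∀ x y → f₁ x ≡ f₂ y → ∃[ z ] (π₁ z ≡ x × π₂ z ≡ y)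

Pullback-lift : ∀ {p} {f₁ : Fin n → Fin n″} {f₂ : Fin n′ → Fin n″} {π₁ : Fin p → Fin n} {π₂ : Fin p → Fin n′} →
  Pullback f₁ f₂ π₁ π₂ → Pullback (lift 1 f₁) (lift 1 f₂) (lift 1 π₁) (lift 1 π₂)
Pullback-lift h zero    zero    e = zero , refl , refl
Pullback-lift h (suc x) (suc y) e with h x y (suc-injective e)
... | z , refl , refl = suc z , refl , refl

Pullback-suc : {f : Fin n → Fin n′} → Pullback (lift 1 f) suc suc f
Pullback-suc zero    y ()
Pullback-suc (suc x) y e = x , refl , suc-injective e

Pullback-id : {f : Fin n → Fin n′} → Pullback f id id f
Pullback-id x y e = x , refl , e

var-injective : {x y : Fin n} → _≡_ {A = Term n m} (var x) (var y) → x ≡ y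
var-injective refl = refl

ƛ-injective : {M M′ : Term (suc n) m} → _≡_ {A = Term n m} (ƛ M) (ƛ M′) → M ≡ M′
ƛ-injective refl = refl

·-injective : {M M′ N N′ : Term n m} → _≡_ {A = Term n m} (M · N) (M′ · N′) → M ≡ M′ × N ≡ N′
·-injective refl = refl , refl

where-injective : {L L′ : Exp s (suc n) m} {M M′ : Term n m} →
                  _≡_ {A = Exp s n m} (L where:= M) (L′ where:= M′) → L ≡ L′ × M ≡ M′
where-injective refl = refl , refl

μ-injective : {J J′ : Jump n (suc m)} → _≡_ {A = Term n m} (μ J) (μ J′) → J ≡ J′
μ-injective refl = refl

[]-injective : {k k′ : Fin m} {M M′ : Term n m} → _≡_ {A = Jump n m} ([ k ] M) ([ k′ ] M′) → k ≡ k′ × M ≡ M′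
[]-injective refl = refl , refl

pullback : ∀ {p q} {ρ₁ : Fin n → Fin n″} {ρ₂ : Fin n′ → Fin n″} {π₁ : Fin p → Fin n} {π₂ : Fin p → Fin n′}
  {κ₁ : Fin m → Fin m″} {κ₂ : Fin m′ → Fin m″} {ξ₁ : Fin q → Fin m} {ξ₂ : Fin q → Fin m′} →
  Pullback ρ₁ ρ₂ π₁ π₂ → Pullback κ₁ κ₂ ξ₁ ξ₂ →
  (M : Exp s n m) (N : Exp s n′ m′) → ren ρ₁ κ₁ M ≡ ren ρ₂ κ₂ N →
  ∃[ P ] (ren π₁ ξ₁ P ≡ M × ren π₂ ξ₂ P ≡ N)
pullback f g (var x) (var y) e with f x y (var-injective e)
... | z , refl , refl = var z , refl , refl
pullback f g (ƛ M) (ƛ N) e with pullback (Pullback-lift f) g M N (ƛ-injective e)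
... | P , refl , refl = ƛ P , refl , refl
pullback f g (M · M′) (N · N′) e with ·-injective e
... | e₁ , e₂ with pullback f g M N e₁ | pullback f g M′ N′ e₂
... | P , refl , refl | P′ , refl , refl = P · P′ , refl , refl
pullback f g (M where:= M′) (N where:= N′) e with where-injective e
... | e₁ , e₂ with pullback (Pullback-lift f) g M N e₁ | pullback f g M′ N′ e₂
... | P , refl , refl | P′ , refl , refl = (P where:= P′) , refl , refl
pullback f g (μ J) (μ J′) e with pullback f (Pullback-lift g) J J′ (μ-injective e)
... | P , refl , refl = μ P , refl , refl
pullback f g ([ k ] M) ([ l ] N) e with []-injective e
... | e₁ , e₂ with g k l e₁ | pullback f g M N e₂
... | j , refl , refl | P , refl , refl = [ j ] P , refl , refl

-- Freshness conditions are phrased by weakenings, so pulling a step back along a renaming means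
-- recovering the weakened subterm: `wk` for ηλ, `wkᶜ` for E2 and ημ, `wk₁` for E1.
wk-pullback : (ρ : Fin n → Fin n′) (κ : Fin m → Fin m′) (X : Exp s (suc n) m) (M : Exp s n′ m′) →
  ren (lift 1 ρ) κ X ≡ wk M → ∃[ M₀ ] (wk M₀ ≡ X × ren ρ κ M₀ ≡ M)
wk-pullback ρ κ = pullback Pullback-suc Pullback-id

wkᶜ-pullback : (ρ : Fin n → Fin n′) (κ : Fin m → Fin m′) (X : Exp s n (suc m)) (M : Exp s n′ m′) →
  ren ρ (lift 1 κ) X ≡ wkᶜ M → ∃[ M₀ ] (wkᶜ M₀ ≡ X × ren ρ κ M₀ ≡ M)
wkᶜ-pullback ρ κ = pullback Pullback-id Pullback-suc

wk₁-pullback : (ρ : Fin n → Fin n′) (κ : Fin m → Fin m′) (X : Exp s (suc (suc n)) m) (M : Exp s (suc n′) m′) →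
  ren (lift 1 (lift 1 ρ)) κ X ≡ wk₁ M → ∃[ M₀ ] (wk₁ M₀ ≡ X × ren (lift 1 ρ) κ M₀ ≡ M)
wk₁-pullback ρ κ = pullback (Pullback-lift Pullback-suc) Pullback-id

wkᶜ-injective : (M N : Exp s n m) → wkᶜ M ≡ wkᶜ N → M ≡ N
wkᶜ-injective M N e with pullback {π₁ = id} {π₂ = id} {ξ₁ = id} {ξ₂ = id}
  (λ x y e → x , refl , e) (λ k l e → k , refl , suc-injective e) M N e
... | P , p , q = trans (sym p) q

-- Lifting steps along renamings

-- When `mu` has contracted `μ [ zero ] wkᶜ M`, whatever happens to `wkᶜ M` must be carried out on
-- `M`. Symmetry of the congruence forces a mutual proof for the reversed direction.
un≈ : (ρ : Fin n → Fin n′) (κ : Fin m → Fin m′) {P P′ : Exp s n′ m′} → P ≈ P′ →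
      (P₀ : Exp s n m) → ren ρ κ P₀ ≡ P → ∃[ P₀′ ] (ren ρ κ P₀′ ≡ P′ × P₀ ≈ P₀′)
un≈˘ : (ρ : Fin n → Fin n′) (κ : Fin m → Fin m′) {P P′ : Exp s n′ m′} → P′ ≈ P →
       (P₀ : Exp s n m) → ren ρ κ P₀ ≡ P → ∃[ P₀′ ] (ren ρ κ P₀′ ≡ P′ × P₀ ≈ P₀′)

un≈ ρ κ (base (E1 _ _ _)) (L where:= (M where:= N)) refl =
  ((wk₁ L where:= M) where:= N) , cong (λ z → z where:= _ where:= _) (ren-wk₁ L) , base (E1 L M N)
un≈ ρ κ (base (E2 _ _)) ((μ J) where:= M) refl =
  (μ (J where:= wkᶜ M)) , cong (λ z → μ (_ where:= z)) (ren-wkᶜ M) , base (E2 J M)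
un≈ ρ κ (base (E3 _ _ _)) ([ k ] (L where:= M)) refl = (([ k ] L) where:= M) , refl , base (E3 k L M)
un≈ ρ κ ≈-refl        P₀ e = P₀ , e , ≈-refl
un≈ ρ κ (≈-sym d)     P₀ e = un≈˘ ρ κ d P₀ e
un≈ ρ κ (≈-trans c d) P₀ e with un≈ ρ κ c P₀ e
... | P₁ , e₁ , c₀ with un≈ ρ κ d P₁ e₁
... | P₂ , e₂ , d₀ = P₂ , e₂ , ≈-trans c₀ d₀
un≈ ρ κ (ƛ d) (ƛ M) refl with un≈ (lift 1 ρ) κ d M refl
... | M₀ , refl , d₀ = ƛ M₀ , refl , ƛ d₀
un≈ ρ κ (c · d) (M · N) refl with un≈ ρ κ c M refl | un≈ ρ κ d N refl
... | M₀ , refl , c₀ | N₀ , refl , d₀ = M₀ · N₀ , refl , c₀ · d₀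
un≈ ρ κ (c where:= d) (M where:= N) refl with un≈ (lift 1 ρ) κ c M refl | un≈ ρ κ d N refl
... | M₀ , refl , c₀ | N₀ , refl , d₀ = (M₀ where:= N₀) , refl , (c₀ where:= d₀)
un≈ ρ κ (μ d) (μ J) refl with un≈ ρ (lift 1 κ) d J refl
... | J₀ , refl , d₀ = μ J₀ , refl , μ d₀
un≈ ρ κ ([ _ ] d) ([ k ] M) refl with un≈ ρ κ d M refl
... | M₀ , refl , d₀ = [ k ] M₀ , refl , [ k ] d₀

un≈˘ ρ κ (base (E1 L _ _)) ((X where:= M) where:= N) e with where-injective e
... | e′ , refl with where-injective e′
... | e″ , refl with wk₁-pullback ρ κ X L e″
... | L₀ , refl , refl = (L₀ where:= (M where:= N)) , refl , ≈-sym (base (E1 L₀ M N))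
un≈˘ ρ κ (base (E2 _ M)) (μ (J where:= X)) e with where-injective (μ-injective e)
... | refl , e′ with wkᶜ-pullback ρ κ X M e′
... | M₀ , refl , refl = ((μ J) where:= M₀) , refl , ≈-sym (base (E2 J M₀))
un≈˘ ρ κ (base (E3 _ _ _)) (([ k ] L) where:= M) refl = [ k ] (L where:= M) , refl , ≈-sym (base (E3 k L M))
un≈˘ ρ κ ≈-refl        P₀ e = P₀ , e , ≈-refl
un≈˘ ρ κ (≈-sym d)     P₀ e = un≈ ρ κ d P₀ e
un≈˘ ρ κ (≈-trans c d) P₀ e with un≈˘ ρ κ d P₀ e
... | P₁ , e₁ , d₀ with un≈˘ ρ κ c P₁ e₁
... | P₂ , e₂ , c₀ = P₂ , e₂ , ≈-trans d₀ c₀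
un≈˘ ρ κ (ƛ d) (ƛ M) refl with un≈˘ (lift 1 ρ) κ d M refl
... | M₀ , refl , d₀ = ƛ M₀ , refl , ƛ d₀
un≈˘ ρ κ (c · d) (M · N) refl with un≈˘ ρ κ c M refl | un≈˘ ρ κ d N refl
... | M₀ , refl , c₀ | N₀ , refl , d₀ = M₀ · N₀ , refl , c₀ · d₀
un≈˘ ρ κ (c where:= d) (M where:= N) refl with un≈˘ (lift 1 ρ) κ c M refl | un≈˘ ρ κ d N refl
... | M₀ , refl , c₀ | N₀ , refl , d₀ = (M₀ where:= N₀) , refl , (c₀ where:= d₀)
un≈˘ ρ κ (μ d) (μ J) refl with un≈˘ ρ (lift 1 κ) d J refl
... | J₀ , refl , d₀ = μ J₀ , refl , μ d₀
un≈˘ ρ κ ([ _ ] d) ([ k ] M) refl with un≈˘ ρ κ d M refl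
... | M₀ , refl , d₀ = [ k ] M₀ , refl , [ k ] d₀

value-ren : {ρ : Fin n → Fin n′} {κ : Fin m → Fin m′} {M : Term n m} → Value M → Value (ren ρ κ M)
value-ren (var x) = var _
value-ren (ƛ M)   = ƛ _

value-unren : {ρ : Fin n → Fin n′} {κ : Fin m → Fin m′} (M : Term n m) → Value (ren ρ κ M) → Value M
value-unren (var x) v = var x
value-unren (ƛ M)   v = ƛ M

lift-zero : (f : Fin n → Fin n′) → ∀ x → lift 1 f x ≡ zero → x ≡ zero
lift-zero f zero    e = refl
lift-zero f (suc x) ()

un↦ : (ρ : Fin n → Fin n′) (κ : Fin m → Fin m′) {P P′ : Exp s n′ m′} → P ↦ P′ →
      (P₀ : Exp s n m) → ren ρ κ P₀ ≡ P → ∃[ P₀′ ] (ren ρ κ P₀′ ≡ P′ × P₀ ↦ P₀′)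
un↦ ρ κ (ad₁ ¬v) (N · M) refl =
  _ , cong (λ z → (_ · z) where:= _) (ren-wk M) , ad₁ (¬v ∘ value-ren)
un↦ ρ κ (ad₂ v ¬v) (V · N) refl =
  _ , cong (λ z → (z · _) where:= _) (ren-wk V) , ad₂ (value-unren V v) (¬v ∘ value-ren)
un↦ ρ κ (βλ v) ((ƛ M) · V) refl = _ , refl , βλ (value-unren V v)
un↦ ρ κ (βw v) (M where:= V) refl = _ , ren-⟨⟩ M V , βw (value-unren V v)
un↦ ρ κ βμ (M where:= (μ J)) refl =
  _ , cong μ_ (trans (ren-⟪⟫ (lift-zero κ) J (wkᶜ M)) (cong (ren ρ (lift 1 κ) J ⟪ zero ↦_⟫) (ren-wkᶜ M))) , βμ
un↦ ρ κ βj ([ l ] (μ J)) refl = _ , ren-⟨⟩ᶜ J l , βj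
un↦ ρ κ (ηλ {V = V} v) (ƛ (X · var zero)) e with ·-injective (ƛ-injective e)
... | e′ , _ with wk-pullback ρ κ X V e′
... | V₀ , refl , refl = V₀ , refl , ηλ (value-unren V₀ v)
un↦ ρ κ (ηλ v) (ƛ (X · var (suc x))) e with ·-injective (ƛ-injective e)
... | _ , ()
un↦ ρ κ ηw (var zero where:= M) refl = M , refl , ηw
un↦ ρ κ (ημ {M = M}) (μ ([ zero ] X)) e with []-injective (μ-injective e)
... | _ , e′ with wkᶜ-pullback ρ κ X M e′
... | M₀ , refl , refl = M₀ , refl , ημ
un↦ ρ κ ημ (μ ([ suc k ] X)) e with []-injective (μ-injective e)
... | () , _

unCompat : (ρ : Fin n → Fin n′) (κ : Fin m → Fin m′) {P P′ : Exp s n′ m′} → Compat _↦_ P P′ →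
           (P₀ : Exp s n m) → ren ρ κ P₀ ≡ P → ∃[ P₀′ ] (ren ρ κ P₀′ ≡ P′ × Compat _↦_ P₀ P₀′)
unCompat ρ κ (base d) P₀ e with un↦ ρ κ d P₀ e
... | P₀′ , e′ , d₀ = P₀′ , e′ , base d₀
unCompat ρ κ (ƛ d) (ƛ M) refl with unCompat (lift 1 ρ) κ d M refl
... | M₀ , refl , d₀ = ƛ M₀ , refl , ƛ d₀
unCompat ρ κ (·ˡ d) (M · N) refl with unCompat ρ κ d M refl
... | M₀ , refl , d₀ = M₀ · N , refl , ·ˡ d₀
unCompat ρ κ (·ʳ d) (M · N) refl with unCompat ρ κ d N refl
... | N₀ , refl , d₀ = M · N₀ , refl , ·ʳ d₀
unCompat ρ κ (whereˡ d) (L where:= M) refl with unCompat (lift 1 ρ) κ d L refl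
... | L₀ , refl , d₀ = (L₀ where:= M) , refl , whereˡ d₀
unCompat ρ κ (whereʳ d) (L where:= M) refl with unCompat ρ κ d M refl
... | M₀ , refl , d₀ = (L where:= M₀) , refl , whereʳ d₀
unCompat ρ κ (μ d) (μ J) refl with unCompat ρ (lift 1 κ) d J refl
... | J₀ , refl , d₀ = μ J₀ , refl , μ d₀
unCompat ρ κ ([ _ ] d) ([ k ] M) refl with unCompat ρ κ d M refl
... | M₀ , refl , d₀ = [ k ] M₀ , refl , [ k ] d₀

un⟶* : (ρ : Fin n → Fin n′) (κ : Fin m → Fin m′) {P P′ : Exp s n′ m′} → P ⟶* P′ →
       (P₀ : Exp s n m) → ren ρ κ P₀ ≡ P → ∃[ P₀′ ] (ren ρ κ P₀′ ≡ P′ × P₀ ⟶* P₀′)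
un⟶* ρ κ (done d) P₀ e with un≈ ρ κ d P₀ e
... | P₁ , e₁ , d₀ = P₁ , e₁ , done d₀
un⟶* ρ κ (step (_ , _ , c , d , c′) ds) P₀ e with un≈ ρ κ c P₀ e
... | P₁ , e₁ , c₀ with unCompat ρ κ d P₁ e₁
... | P₂ , e₂ , d₀ with un≈ ρ κ c′ P₂ e₂
... | P₃ , e₃ , c₀′ with un⟶* ρ κ ds P₃ e₃
... | P₄ , e₄ , ds₀ = P₄ , e₄ , step (_ , _ , c₀ , d₀ , c₀′) ds₀

-- Congruence of reduction

≈-reflexive : {P P′ : Exp s n m} → P ≡ P′ → P ≈ P′
≈-reflexive refl = ≈-refl

≈-⟶* : {P P′ P″ : Exp s n m} → P ≈ P′ → P′ ⟶* P″ → P ⟶* P″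
≈-⟶* c (done d) = done (≈-trans c d)
≈-⟶* c (step (A , B , c₁ , d , c₂) ds) = step (A , B , ≈-trans c c₁ , d , c₂) ds

⟶*-trans : {P P′ P″ : Exp s n m} → P ⟶* P′ → P′ ⟶* P″ → P ⟶* P″
⟶*-trans (done c)    es = ≈-⟶* c es
⟶*-trans (step d ds) es = step d (⟶*-trans ds es)

⟶*-reflexive : {P P′ : Exp s n m} → P ≡ P′ → P ⟶* P′
⟶*-reflexive e = done (≈-reflexive e)

↦⇒⟶* : {P P′ : Exp s n m} → P ↦ P′ → P ⟶* P′
↦⇒⟶* d = step (_ , _ , ≈-refl , base d , ≈-refl) (done ≈-refl)

⟶*-map : {f : Exp s n m → Exp s′ n′ m′} →
         (∀ {P P′} → P ≈ P′ → f P ≈ f P′) →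
         (∀ {P P′} → Compat _↦_ P P′ → Compat _↦_ (f P) (f P′)) →
         ∀ {P P′} → P ⟶* P′ → f P ⟶* f P′
⟶*-map f g (done c) = done (f c)
⟶*-map f g (step (_ , _ , c , d , c′) ds) = step (_ , _ , f c , g d , f c′) (⟶*-map f g ds)

⟶*-ƛ : {M M′ : Term (suc n) m} → M ⟶* M′ → (ƛ M) ⟶* (ƛ M′)
⟶*-ƛ = ⟶*-map ƛ_ ƛ_

⟶*-· : {M M′ N N′ : Term n m} → M ⟶* M′ → N ⟶* N′ → M · N ⟶* M′ · N′
⟶*-· d e = ⟶*-trans (⟶*-map (_· ≈-refl) ·ˡ d) (⟶*-map (≈-refl ·_) ·ʳ e)

⟶*-where : {L L′ : Exp s (suc n) m} {M M′ : Term n m} → L ⟶* L′ → M ⟶* M′ →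
           (L where:= M) ⟶* (L′ where:= M′)
⟶*-where d e = ⟶*-trans (⟶*-map (_where:= ≈-refl) whereˡ d) (⟶*-map (≈-refl where:=_) whereʳ e)

⟶*-μ : {J J′ : Jump n (suc m)} → J ⟶* J′ → (μ J) ⟶* (μ J′)
⟶*-μ = ⟶*-map μ_ μ_

⟶*-[] : (k : Fin m) {M M′ : Term n m} → M ⟶* M′ → ([ k ] M) ⟶* ([ k ] M′)
⟶*-[] k = ⟶*-map ([ k ]_) ([ k ]_)

-- Abstraction of a continuation with ημ built in

mu : Fin (suc m) → Term n (suc m) → Term n m
mu zero M with zero ∉? M
... | yes p = proj₁ (strengthenᶜ M p)
... | no  _ = μ [ zero ] M
mu (suc k) M = μ [ suc k ] M

-- Case analysis on `mu` that hides the decision procedure: in the contracted case the body is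
-- literally a weakening.
data MuView {n m} : Fin (suc m) → Term n (suc m) → Term n m → Set where
  lin : (M : Term n m) → MuView zero (wkᶜ M) M
  non : ∀ {t M} → (t ≡ zero → ¬ (zero ∉ M)) → MuView t M (μ [ t ] M)

muView : (t : Fin (suc m)) (M : Term n (suc m)) → MuView t M (mu t M)
muView zero M with zero ∉? M
... | yes p with M₀ , refl ← strengthenᶜ M p = lin M₀
... | no ¬p = non (λ _ → ¬p)
muView (suc t) M = non (λ ())

mu-lin : (M : Term n m) → mu zero (wkᶜ M) ≡ M
mu-lin M with zero ∉? wkᶜ M
... | yes p = wkᶜ-injective _ M (proj₂ (strengthenᶜ (wkᶜ M) p))
... | no ¬p = contradiction (zero∉wkᶜ M) ¬p

mu-non : (t : Fin (suc m)) (M : Term n (suc m)) → (t ≡ zero → ¬ (zero ∉ M)) → mu t M ≡ μ [ t ] M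
mu-non zero M h with zero ∉? M
... | yes p = contradiction p (h refl)
... | no _  = refl
mu-non (suc t) M h = refl

mu-ren : {ρ : Fin n → Fin n′} {κ : Fin m → Fin m′} (t : Fin (suc m)) (M : Term n (suc m)) →
         ren ρ κ (mu t M) ≡ mu (lift 1 κ t) (ren ρ (lift 1 κ) M)
mu-ren {κ = κ} t M with mu t M | muView t M
... | .M₀ | lin M₀ = sym (trans (cong (mu zero) (ren-wkᶜ M₀)) (mu-lin _))
... | ._  | non h  = sym (mu-non _ _ (λ e p → h (lift-zero κ t e) (∉-unren refl M p)))

mu-sub : {σ : Fin n → Term n′ m} (t : Fin (suc m)) (M : Term n (suc m)) →
         sub σ (mu t M) ≡ mu t (sub (wkᶜ ∘ σ) M)
mu-sub t M with mu t M | muView t M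
... | .M₀ | lin M₀ = sym (trans (cong (mu zero) (sym (ren-sub (λ _ → refl) M₀))) (mu-lin _))
... | ._  | non h  = sym (mu-non _ _ (λ e p → h e (∉-sub M p)))

-- The outermost layer of `_⟪_↦_⟫` on a jump `[ t ] M` represented as a pair; the continuation `t`
-- itself stays.
replace : Fin m → Term (suc n) m → Fin m → Term n m → Term n m
replace k L t M with t ≟ k
... | yes _ = L where:= M
... | no  _ = M

mu-⟪⟫ : {k : Fin m} {L : Term (suc n) m} (t : Fin (suc m)) (M : Term n (suc m)) →
        mu t M ⟪ k ↦ L ⟫ ≡ mu t (replace (suc k) (wkᶜ L) t (M ⟪ suc k ↦ wkᶜ L ⟫))
mu-⟪⟫ {k = k} {L} t M with mu t M | muView t M
... | .M₀ | lin M₀ = sym (trans (cong (mu zero) (sym (trans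
        (ren-⟪⟫ (λ _ → suc-injective) M₀ L)
        (cong (wkᶜ M₀ ⟪ suc k ↦_⟫) (ren-cong (lift-id (λ _ → refl)) (λ _ → refl) L))))) (mu-lin _))
... | ._  | non h with t ≟ suc k
... | yes refl = refl
... | no _     = sym (mu-non _ _ (λ e p → h e (∉-⟪⟫ M p)))

-- Being an ημ-redex is invariant under `≈`, since congruences descend along `wkᶜ` in both
-- directions; so both sides fall into the same case of `mu`.
mu-≈ : (t : Fin (suc m)) {M M′ : Term n (suc m)} → M ≈ M′ → mu t M ≈ mu t M′
mu-≈ t {M} {M′} d with mu t M | muView t M
... | .M₀ | lin M₀ with M₀′ , refl , d₀ ← un≈ id suc d M₀ refl =
  ≈-trans d₀ (≈-reflexive (sym (mu-lin M₀′)))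
... | ._ | non h = ≈-trans (μ ([ t ] d)) (≈-reflexive (sym (mu-non t M′ h′)))
  where
  h′ : t ≡ zero → ¬ (zero ∉ M′)
  h′ e p with M₀′ , refl ← strengthenᶜ M′ p with M₀ , refl , _ ← un≈˘ id suc d M₀′ refl =
    h e (zero∉wkᶜ M₀)

μ⟶*mu : (t : Fin (suc m)) (M : Term n (suc m)) → (μ [ t ] M) ⟶* mu t M
μ⟶*mu t M with mu t M | muView t M
... | .M₀ | lin M₀ = ↦⇒⟶* ημ
... | ._  | non h  = done ≈-refl

-- The renaming behind `_⟨_⟩ᶜ`, which is local to that definition and needs a name here.
point : Fin m → Fin (suc m) → Fin m
point l zero    = l
point l (suc k) = k

⟨⟩ᶜ-point : (M : Exp s n (suc m)) (l : Fin m) → M ⟨ l ⟩ᶜ ≡ ren id (point l) M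
⟨⟩ᶜ-point M l = ren-cong (λ _ → refl) (λ { zero → refl ; (suc k) → refl }) M

ren-point-wkᶜ : (M : Exp s n m) {l : Fin m} → ren id (point l) (wkᶜ M) ≡ M
ren-point-wkᶜ M = trans (ren-ren (λ _ → refl) (λ _ → refl) M) (ren-id (λ _ → refl) (λ _ → refl) M)

-- This is βj where `mu` has kept the μ. Where it has contracted, ημ has already produced the jump
-- that βj would give.
[]mu⟶* : (l : Fin m) (t : Fin (suc m)) (M : Term n (suc m)) →
         ([ l ] mu t M) ⟶* ([ point l t ] ren id (point l) M)
[]mu⟶* l t M with mu t M | muView t M
... | .M₀ | lin M₀ = ⟶*-reflexive (cong ([ l ]_) (sym (ren-point-wkᶜ M₀)))
... | ._  | non h  = ⟶*-trans (↦⇒⟶* βj) (⟶*-reflexive (⟨⟩ᶜ-point ([ t ] M) l))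

wkᶜ-where : (L : Exp s (suc n) m) (M : Term n m) → wkᶜ (L where:= M) ≡ (wkᶜ L where:= wkᶜ M)
wkᶜ-where L M = cong (_where:= _) (ren-cong (lift-id (λ _ → refl)) (λ _ → refl) L)

mu-where : (t : Fin (suc m)) (L : Term (suc n) (suc m)) (M : Term n m) →
           (mu t L where:= M) ≈ mu t (L where:= wkᶜ M)
mu-where t L M with mu t L | muView t L
... | .L₀ | lin L₀ = ≈-reflexive (sym (trans (cong (mu zero) (sym (wkᶜ-where L₀ M))) (mu-lin _)))
... | ._  | non h  = ≈-trans (base (E2 _ M)) (≈-trans (μ (≈-sym (base (E3 t L _))))
        (≈-reflexive (sym (mu-non _ _ (λ e p → h e (proj₁ p))))))

-- A continuation variable absent from the result of `mu` is absent from the jump under it. There it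
-- is shifted past the variable bound by `mu`, hence `lift 1 suc`.
mu-unwkᶜ : (t : Fin (suc (suc m))) (M : Term n (suc (suc m))) (X : Term n m) → wkᶜ X ≡ mu t M →
           ∃[ t₀ ] ∃[ M₀ ] (lift 1 suc t₀ ≡ t × ren id (lift 1 suc) M₀ ≡ M × mu t₀ M₀ ≡ X)
mu-unwkᶜ t M X e with mu t M | muView t M
... | .M₀ | lin M₀ with refl ← e = zero , wkᶜ X , refl , ren-wkᶜ X , mu-lin X
mu-unwkᶜ t M (μ ([ t₀ ] M₀)) refl | ._ | non h =
  t₀ , M₀ , refl , refl , mu-non t₀ M₀ (λ { refl p → h refl (∉-ren (lift-zero suc) M₀ p) })

infix 4 _⇝_

-- A pair (t , M) stands for the jump [ t ] M.  Here u and N describe the reduct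
-- of that jump with its outermost continuation kept distinct from the other
-- occurrences of t.
_⇝_ : Fin m × Term n m → Fin m × Term n m → Set
(t , M) ⇝ (t′ , M′) = ∃[ u ] ∃[ N ] (M ⟶* mu u N × point t u ≡ t′ × ren id (point t) N ≈ M′)

-- If the μ is present, βj merges it with the `mu` of the reduct. If it has been contracted, there
-- is no jump left for βj; but then `M` is weakened, so its reduct `mu u N` descends to the
-- contractum, and replacing the variable bound there by `zero` only undoes the weakening.
⇝-mu : {t t′ : Fin (suc m)} {M M′ : Term n (suc m)} → (t , M) ⇝ (t′ , M′) → mu t M ⟶* mu t′ M′
⇝-mu {t = t} {M = M} {M′} (u , N , d , refl , e) with mu t M | muView t M
... | .M₀ | lin M₀ with X , eX , d₀ ← un⟶* id suc d M₀ refl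
                   with u₀ , N₀ , refl , refl , refl ← mu-unwkᶜ u N X eX =
  ⟶*-trans d₀ (done (≈-trans (mu-≈ u₀ (≈-trans (≈-reflexive (sym N₀≡)) e))
    (≈-reflexive (cong (λ z → mu z M′) (sym (point-lift u₀))))))
  where
  point-lift : ∀ {m} (k : Fin (suc m)) → point zero (lift 1 suc k) ≡ k
  point-lift zero    = refl
  point-lift (suc k) = refl
  N₀≡ : ren id (point zero) (ren id (lift 1 suc) N₀) ≡ N₀
  N₀≡ = trans (ren-ren (λ _ → refl) point-lift N₀) (ren-id (λ _ → refl) (λ _ → refl) N₀)
... | ._ | non h = ⟶*-trans (⟶*-μ (⟶*-[] t d)) (⟶*-trans (⟶*-μ ([]mu⟶* t u N))
  (≈-⟶* (μ ([ _ ] e)) (μ⟶*mu _ M′)))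

⇝-where : {t t′ : Fin m} {L L′ : Term (suc n) m} {M : Term n m} →
          (t , L) ⇝ (t′ , L′) → (t , (L where:= M)) ⇝ (t′ , (L′ where:= M))
⇝-where {M = M} (u , N , d , e , f) = u , (N where:= wkᶜ M) ,
  ⟶*-trans (⟶*-where d (done ≈-refl)) (done (mu-where u N M)) , e ,
  (≈-trans (≈-reflexive (ren-cong (lift-id (λ _ → refl)) (λ _ → refl) N)) f
    where:= ≈-reflexive (ren-point-wkᶜ M))

⟶*⇒⇝ : {t : Fin m} {M M′ : Term n m} → M ⟶* M′ → (t , M) ⇝ (t , M′)
⟶*⇒⇝ {M′ = M′} d =
  zero , wkᶜ M′ , ⟶*-trans d (⟶*-reflexive (sym (mu-lin M′))) , refl , ≈-reflexive (ren-point-wkᶜ M′)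

-- The inverse translation

-- No rule binds a variable of kind T or Q. Their empty name types make `Env` available only for
-- contexts made of W and K.
Name : Kind → ℕ → ℕ → Set
Name W n m = Fin n
Name K n m = Fin m
Name T n m = ⊥
Name Q n m = ⊥

renName : (Fin n → Fin n′) → (Fin m → Fin m′) → ∀ a → Name a n m → Name a n′ m′
renName ρ κ W x = ρ x
renName ρ κ K k = κ k

Env : Cx → ℕ → ℕ → Set
Env Γ n m = ∀ {a} → Γ ∋ a → Name a n m

liftW : Env Γ n m → Env (W ∷ Γ) (suc n) m
liftW ν ze         = zero
liftW ν (su {a} x) = renName suc id a (ν x)

liftK : Env Γ n m → Env (K ∷ Γ) n (suc m)
liftK ν ze         = zero
liftK ν (su {a} x) = renName id suc a (ν x)

-- The pair (t , M) in kind Q stands for the jump [ t ] M; in kind K, the pair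
-- (t , nothing) stands for [ t ] □ and (t , just L) for [ t ] (L where:= □).
Sem : Kind → ℕ → ℕ → Set
Sem W n m = Term n m
Sem K n m = Fin m × Maybe (Term (suc n) m)
Sem T n m = Term n m
Sem Q n m = Fin m × Term n m

name : ∀ a → Name a n m → Sem a n m
name W x = var x
name K k = k , nothing

plug : Maybe (Term (suc n) m) → Term n m → Term n m
plug nothing  M = M
plug (just L) M = L where:= M

-- In the Q clauses `plug` keeps the `where` inside the bracket, the side of E3 chosen as normal
-- form of jumps.
inv : Env Γ n m → Tm Γ a → Sem a n m
inv {a = a} ν (var x)  = name a (ν x)
inv ν (lam rW M)   = ƛ inv (liftW ν) M
inv ν (lam rK M)   = proj₁ (inv (liftW ν) M) , just (proj₂ (inv (liftW ν) M))
inv ν (lam rT M)   = mu (proj₁ (inv (liftK ν) M)) (proj₂ (inv (liftK ν) M))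
inv ν (app rW M N) = inv ν M · inv ν N
inv ν (app rK M N) = proj₁ (inv ν M) , plug (proj₂ (inv ν M)) (inv ν N)
inv ν (app rT M N) = proj₁ (inv ν N) , plug (proj₂ (inv ν N)) (inv ν M)

inv-value : {ν : Env Γ n m} (M : Tm Γ W) → Value (inv ν M)
inv-value (var x)    = var _
inv-value (lam rW M) = ƛ _

-- Renaming and value substitution under the inverse translation

inv-renᵗ : {ρ : Renᵗ Γ Δ} {ν : Env Δ n m} {ν′ : Env Γ n m} →
           (∀ {a} (x : Γ ∋ a) → ν (ρ x) ≡ ν′ x) → (M : Tm Γ a) → inv ν (renᵗ ρ M) ≡ inv ν′ M
inv-renᵗ {a = a} e (var x) = cong (name a) (e x)
inv-renᵗ e (lam rW M) = cong ƛ_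
  (inv-renᵗ (λ { ze → refl ; (su {a} x) → cong (renName suc id a) (e x) }) M)
inv-renᵗ e (lam rK M) = cong (λ p → proj₁ p , just (proj₂ p))
  (inv-renᵗ (λ { ze → refl ; (su {a} x) → cong (renName suc id a) (e x) }) M)
inv-renᵗ e (lam rT M) = cong (λ p → mu (proj₁ p) (proj₂ p))
  (inv-renᵗ (λ { ze → refl ; (su {a} x) → cong (renName id suc a) (e x) }) M)
inv-renᵗ e (app rW M N) = cong₂ _·_ (inv-renᵗ e M) (inv-renᵗ e N)
inv-renᵗ e (app rK M N) = cong₂ (λ p q → proj₁ p , plug (proj₂ p) q) (inv-renᵗ e M) (inv-renᵗ e N)
inv-renᵗ e (app rT M N) = cong₂ (λ q p → proj₁ p , plug (proj₂ p) q) (inv-renᵗ e M) (inv-renᵗ e N)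

renSem : (Fin n → Fin n′) → (Fin m → Fin m′) → ∀ a → Sem a n m → Sem a n′ m′
renSem ρ κ W M       = ren ρ κ M
renSem ρ κ K (t , L) = κ t , mapᴹ (ren (lift 1 ρ) κ) L
renSem ρ κ T M       = ren ρ κ M
renSem ρ κ Q (t , M) = κ t , ren ρ κ M

ren-plug : {ρ : Fin n → Fin n′} {κ : Fin m → Fin m′} (L : Maybe (Term (suc n) m)) (M : Term n m) →
           ren ρ κ (plug L M) ≡ plug (mapᴹ (ren (lift 1 ρ) κ) L) (ren ρ κ M)
ren-plug nothing  M = refl
ren-plug (just L) M = refl

renSem-name : (ρ : Fin n → Fin n′) (κ : Fin m → Fin m′) (a : Kind) (x : Name a n m) →
              renSem ρ κ a (name a x) ≡ name a (renName ρ κ a x)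
renSem-name ρ κ W x = refl
renSem-name ρ κ K k = refl

renName-liftW : {ρ : Fin n → Fin n′} {κ : Fin m → Fin m′} {ν : Env Γ n m} {ν′ : Env Γ n′ m′} →
                (∀ {a} (x : Γ ∋ a) → renName ρ κ a (ν x) ≡ ν′ x) →
                ∀ {a} (x : (W ∷ Γ) ∋ a) → renName (lift 1 ρ) κ a (liftW ν x) ≡ liftW ν′ x
renName-liftW e ze             = refl
renName-liftW e (su {W} x)     = cong suc (e x)
renName-liftW e (su {K} x)     = e x
renName-liftW {ν = ν} e (su {T} x) = ⊥-elim (ν x)
renName-liftW {ν = ν} e (su {Q} x) = ⊥-elim (ν x)

renName-liftK : {ρ : Fin n → Fin n′} {κ : Fin m → Fin m′} {ν : Env Γ n m} {ν′ : Env Γ n′ m′} →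
                (∀ {a} (x : Γ ∋ a) → renName ρ κ a (ν x) ≡ ν′ x) →
                ∀ {a} (x : (K ∷ Γ) ∋ a) → renName ρ (lift 1 κ) a (liftK ν x) ≡ liftK ν′ x
renName-liftK e ze             = refl
renName-liftK e (su {W} x)     = e x
renName-liftK e (su {K} x)     = cong suc (e x)
renName-liftK {ν = ν} e (su {T} x) = ⊥-elim (ν x)
renName-liftK {ν = ν} e (su {Q} x) = ⊥-elim (ν x)

ren-inv : {ρ : Fin n → Fin n′} {κ : Fin m → Fin m′} {ν : Env Γ n m} {ν′ : Env Γ n′ m′} →
          (∀ {a} (x : Γ ∋ a) → renName ρ κ a (ν x) ≡ ν′ x) →
          (M : Tm Γ a) → renSem ρ κ a (inv ν M) ≡ inv ν′ M
ren-inv {a = a} {ν = ν} e (var x) = trans (renSem-name _ _ a (ν x)) (cong (name a) (e x))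
ren-inv e (lam rW M) = cong ƛ_ (ren-inv (renName-liftW e) M)
ren-inv e (lam rK M) = cong (λ p → proj₁ p , just (proj₂ p)) (ren-inv (renName-liftW e) M)
ren-inv {ν = ν} e (lam rT M) = trans (mu-ren (proj₁ (inv (liftK ν) M)) _)
  (cong (λ p → mu (proj₁ p) (proj₂ p)) (ren-inv (renName-liftK e) M))
ren-inv e (app rW M N) = cong₂ _·_ (ren-inv e M) (ren-inv e N)
ren-inv {ν = ν} e (app rK M N) = trans (cong (_ ,_) (ren-plug (proj₂ (inv ν M)) _))
  (cong₂ (λ p q → proj₁ p , plug (proj₂ p) q) (ren-inv e M) (ren-inv e N))
ren-inv {ν = ν} e (app rT M N) = trans (cong (_ ,_) (ren-plug (proj₂ (inv ν N)) _))
  (cong₂ (λ q p → proj₁ p , plug (proj₂ p) q) (ren-inv e M) (ren-inv e N))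

inv-liftW-wkᵗ : {ν : Env Γ n m} (M : Tm Γ a) → inv (liftW ν) (wkᵗ M) ≡ renSem suc id a (inv ν M)
inv-liftW-wkᵗ M = trans (inv-renᵗ (λ _ → refl) M) (sym (ren-inv (λ _ → refl) M))

inv-liftK-wkᵗ : {ν : Env Γ n m} (M : Tm Γ a) → inv (liftK ν) (wkᵗ M) ≡ renSem id suc a (inv ν M)
inv-liftK-wkᵗ M = trans (inv-renᵗ (λ _ → refl) M) (sym (ren-inv (λ _ → refl) M))

subSem : (Fin n → Term n′ m) → ∀ a → Sem a n m → Sem a n′ m
subSem τ W M       = sub τ M
subSem τ K (t , L) = t , mapᴹ (sub (exts τ)) L
subSem τ T M       = sub τ M
subSem τ Q (t , M) = t , sub τ M

sub-plug : {τ : Fin n → Term n′ m} (L : Maybe (Term (suc n) m)) (M : Term n m) →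
           sub τ (plug L M) ≡ plug (mapᴹ (sub (exts τ)) L) (sub τ M)
sub-plug nothing  M = refl
sub-plug (just L) M = refl

inv-subᵗ-liftW : {σ : Subᵗ Γ Δ} {ν : Env Δ n m} {ν′ : Env Γ n′ m} {τ : Fin n′ → Term n m} →
  (∀ {a} (x : Γ ∋ a) → inv ν (σ x) ≡ subSem τ a (name a (ν′ x))) →
  ∀ {a} (x : (W ∷ Γ) ∋ a) → inv (liftW ν) (extsᵗ σ x) ≡ subSem (exts τ) a (name a (liftW ν′ x))
inv-subᵗ-liftW e ze = refl
inv-subᵗ-liftW {σ = σ} e (su {W} x) = trans (inv-liftW-wkᵗ (σ x)) (cong wk (e x))
inv-subᵗ-liftW {σ = σ} e (su {K} x) = trans (inv-liftW-wkᵗ (σ x)) (cong (renSem suc id K) (e x))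
inv-subᵗ-liftW {ν′ = ν′} e (su {T} x) = ⊥-elim (ν′ x)
inv-subᵗ-liftW {ν′ = ν′} e (su {Q} x) = ⊥-elim (ν′ x)

inv-subᵗ-liftK : {σ : Subᵗ Γ Δ} {ν : Env Δ n m} {ν′ : Env Γ n′ m} {τ : Fin n′ → Term n m} →
  (∀ {a} (x : Γ ∋ a) → inv ν (σ x) ≡ subSem τ a (name a (ν′ x))) →
  ∀ {a} (x : (K ∷ Γ) ∋ a) → inv (liftK ν) (extsᵗ σ x) ≡ subSem (wkᶜ ∘ τ) a (name a (liftK ν′ x))
inv-subᵗ-liftK e ze = refl
inv-subᵗ-liftK {σ = σ} e (su {W} x) = trans (inv-liftK-wkᵗ (σ x)) (cong wkᶜ (e x))
inv-subᵗ-liftK {σ = σ} e (su {K} x) = trans (inv-liftK-wkᵗ (σ x)) (cong (renSem id suc K) (e x))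
inv-subᵗ-liftK {ν′ = ν′} e (su {T} x) = ⊥-elim (ν′ x)
inv-subᵗ-liftK {ν′ = ν′} e (su {Q} x) = ⊥-elim (ν′ x)

-- The hypothesis makes every continuation variable go to a bare continuation, so that syntactic
-- equality is attainable. Substitution of a proper continuation is the subject of `inv-⟪⟫` and
-- holds only up to `≈`.
inv-subᵗ : {σ : Subᵗ Γ Δ} {ν : Env Δ n m} {ν′ : Env Γ n′ m} {τ : Fin n′ → Term n m} →
           (∀ {a} (x : Γ ∋ a) → inv ν (σ x) ≡ subSem τ a (name a (ν′ x))) →
           (M : Tm Γ a) → inv ν (subᵗ σ M) ≡ subSem τ a (inv ν′ M)
inv-subᵗ e (var x)    = e x
inv-subᵗ {ν = ν} {ν′} e (lam rW M) = cong ƛ_ (inv-subᵗ (inv-subᵗ-liftW {ν = ν} {ν′} e) M)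
inv-subᵗ {ν = ν} {ν′} e (lam rK M) = cong (λ p → proj₁ p , just (proj₂ p))
  (inv-subᵗ (inv-subᵗ-liftW {ν = ν} {ν′} e) M)
inv-subᵗ {ν = ν} {ν′ = ν′} e (lam rT M) = trans
  (cong (λ p → mu (proj₁ p) (proj₂ p)) (inv-subᵗ (inv-subᵗ-liftK {ν = ν} {ν′} e) M))
  (sym (mu-sub (proj₁ (inv (liftK ν′) M)) _))
inv-subᵗ e (app rW M N) = cong₂ _·_ (inv-subᵗ e M) (inv-subᵗ e N)
inv-subᵗ {ν′ = ν′} e (app rK M N) = trans
  (cong₂ (λ p q → proj₁ p , plug (proj₂ p) q) (inv-subᵗ e M) (inv-subᵗ e N))
  (cong (_ ,_) (sym (sub-plug (proj₂ (inv ν′ M)) _)))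
inv-subᵗ {ν′ = ν′} e (app rT M N) = trans
  (cong₂ (λ q p → proj₁ p , plug (proj₂ p) q) (inv-subᵗ e M) (inv-subᵗ e N))
  (cong (_ ,_) (sym (sub-plug (proj₂ (inv ν′ N)) _)))

inv-[]ᵀ : {ν : Env Γ n m} (M : Tm (W ∷ Γ) T) (N : Tm Γ W) →
          inv ν (M [ N ]) ≡ inv (liftW ν) M ⟨ inv ν N ⟩
inv-[]ᵀ {ν = ν} M N = inv-subᵗ {ν = ν} {ν′ = liftW ν} (λ
  { ze → refl ; (su {W} x) → refl ; (su {K} x) → refl
  ; (su {T} x) → ⊥-elim (ν x) ; (su {Q} x) → ⊥-elim (ν x) }) M

inv-[]ᑫ : {ν : Env Γ n m} (M : Tm (W ∷ Γ) Q) (N : Tm Γ W) →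
          inv ν (M [ N ]) ≡ (proj₁ (inv (liftW ν) M) , proj₂ (inv (liftW ν) M) ⟨ inv ν N ⟩)
inv-[]ᑫ {ν = ν} M N = inv-subᵗ {ν = ν} {ν′ = liftW ν} (λ
  { ze → refl ; (su {W} x) → refl ; (su {K} x) → refl
  ; (su {T} x) → ⊥-elim (ν x) ; (su {Q} x) → ⊥-elim (ν x) }) M

-- Substitution of a continuation is structural substitution

replaceᴷ : Fin m → Term (suc n) m′ → Fin m → Maybe (Term (suc n) m′)
replaceᴷ z L t with t ≟ z
... | yes _ = just L
... | no  _ = nothing

-- The meaning of a term before substitution lives over m′ and that after it over
-- m: the variable z is first given the continuation [ z ] (L where:= □) and then
-- renamed by κ.
NameRel : (Fin m′ → Fin m) → Fin m′ → Term (suc n) m′ → ∀ a → Sem a n m → Name a n m′ → Set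
NameRel κ z L W M x = M ≡ var x
NameRel κ z L K C k = C ≡ (κ k , replaceᴷ z (ren id κ L) k)
NameRel κ z L T _ _ = ⊥
NameRel κ z L Q _ _ = ⊥

-- A logical relation: kind K is compared by its action on related terms, because substituting a
-- continuation regroups nested `where`s in a way that only E1 relates.
SemRel : (Fin m′ → Fin m) → Fin m′ → Term (suc n) m′ → ∀ a → Sem a n m → Sem a n m′ → Set
SemRel κ z L W M M′ = M ≈ ren id κ (M′ ⟪ z ↦ L ⟫)
SemRel κ z L K (t , C) (t′ , C′) = t ≡ κ t′ × (∀ {M M′} → M ≈ ren id κ (M′ ⟪ z ↦ L ⟫) →
  plug C M ≈ ren id κ (replace z L t′ (plug C′ M′ ⟪ z ↦ L ⟫)))
SemRel κ z L T M M′ = M ≈ ren id κ (M′ ⟪ z ↦ L ⟫)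
SemRel κ z L Q (t , M) (t′ , M′) = t ≡ κ t′ × M ≈ ren id κ (replace z L t′ (M′ ⟪ z ↦ L ⟫))

ren-lift-id : {κ : Fin m → Fin m′} (M : Exp s (suc n) m) → ren (lift 1 id) κ M ≡ ren id κ M
ren-lift-id = ren-cong (lift-id (λ _ → refl)) (λ _ → refl)

map-replaceᴷ : ∀ {p q} (f : Term (suc n) m → Term (suc n′) m′)
               (z t : Fin p) (z′ t′ : Fin q) {L : Term (suc n) m} →
               (t ≡ z → t′ ≡ z′) → (t′ ≡ z′ → t ≡ z) →
               mapᴹ f (replaceᴷ z L t) ≡ replaceᴷ z′ (f L) t′
map-replaceᴷ f z t z′ t′ g h with t ≟ z | t′ ≟ z′
... | yes _ | yes _ = refl
... | yes p | no ¬q = contradiction (g p) ¬q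
... | no ¬p | yes q = contradiction (h q) ¬p
... | no _  | no _  = refl

NameRel-liftW : {κ : Fin m′ → Fin m} {z : Fin m′} {L : Term (suc n) m′}
  {σ : Subᵗ Γ Δ} {ν : Env Δ n m} {ν′ : Env Γ n m′} →
  (∀ {a} (x : Γ ∋ a) → NameRel κ z L a (inv ν (σ x)) (ν′ x)) →
  ∀ {a} (x : (W ∷ Γ) ∋ a) → NameRel κ z (wk₁ L) a (inv (liftW ν) (extsᵗ σ x)) (liftW ν′ x)
NameRel-liftW e ze = refl
NameRel-liftW {σ = σ} e (su {W} x) = trans (inv-liftW-wkᵗ (σ x)) (cong wk (e x))
NameRel-liftW {κ = κ} {z} {L} {σ = σ} {ν′ = ν′} e (su {K} x) =
  trans (inv-liftW-wkᵗ (σ x)) (trans (cong (renSem suc id K) (e x))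
    (cong (_ ,_) (trans (map-replaceᴷ _ z (ν′ x) z (ν′ x) id id)
      (cong (λ P → replaceᴷ z P (ν′ x)) (ren-square (λ _ → refl) (λ _ → refl) L)))))
NameRel-liftW {ν′ = ν′} e (su {T} x) = ⊥-elim (ν′ x)
NameRel-liftW {ν′ = ν′} e (su {Q} x) = ⊥-elim (ν′ x)

NameRel-liftK : {κ : Fin m′ → Fin m} {z : Fin m′} {L : Term (suc n) m′}
  {σ : Subᵗ Γ Δ} {ν : Env Δ n m} {ν′ : Env Γ n m′} →
  (∀ {a} (x : Γ ∋ a) → NameRel κ z L a (inv ν (σ x)) (ν′ x)) →
  ∀ {a} (x : (K ∷ Γ) ∋ a) →
  NameRel (lift 1 κ) (suc z) (wkᶜ L) a (inv (liftK ν) (extsᵗ σ x)) (liftK ν′ x)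
NameRel-liftK e ze = refl
NameRel-liftK {σ = σ} e (su {W} x) = trans (inv-liftK-wkᵗ (σ x)) (cong wkᶜ (e x))
NameRel-liftK {κ = κ} {z} {L} {σ = σ} {ν′ = ν′} e (su {K} x) =
  trans (inv-liftK-wkᵗ (σ x)) (trans (cong (renSem id suc K) (e x))
    (cong (_ ,_) (trans (map-replaceᴷ _ z (ν′ x) (suc z) (suc (ν′ x)) (cong suc) suc-injective)
      (cong (λ P → replaceᴷ (suc z) P (suc (ν′ x)))
        (trans (ren-lift-id _) (sym (ren-wkᶜ L)))))))
NameRel-liftK {ν′ = ν′} e (su {T} x) = ⊥-elim (ν′ x)
NameRel-liftK {ν′ = ν′} e (su {Q} x) = ⊥-elim (ν′ x)

SemRel-name : {κ : Fin m′ → Fin m} {z : Fin m′} {L : Term (suc n) m′}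
              (a : Kind) {S : Sem a n m} (x : Name a n m′) →
              NameRel κ z L a S x → SemRel κ z L a S (name a x)
SemRel-name W x refl = ≈-refl
SemRel-name {κ = κ} {z} {L} K k refl = refl , λ {M} {M′} → go {M} {M′}
  where
  go : ∀ {M M′} → M ≈ ren id κ (M′ ⟪ z ↦ L ⟫) →
       plug (replaceᴷ z (ren id κ L) k) M ≈ ren id κ (replace z L k (M′ ⟪ z ↦ L ⟫))
  go d with k ≟ z
  ... | yes _ = ≈-reflexive (sym (ren-lift-id L)) where:= d
  ... | no _  = d

-- The associativity law E1 is what lets a where-prefix stay outside.
SemRel-lamK : {κ : Fin m′ → Fin m} {z : Fin m′} {L : Term (suc n) m′}
              (t : Fin m) (P : Term (suc n) m) (t′ : Fin m′) (P′ : Term (suc n) m′) →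
              SemRel κ z (wk₁ L) Q (t , P) (t′ , P′) → SemRel κ z L K (t , just P) (t′ , just P′)
SemRel-lamK {κ = κ} {z} {L} t P t′ P′ (e , d) = e , λ {M} {M′} → go {M} {M′}
  where
  go : ∀ {M M′} → M ≈ ren id κ (M′ ⟪ z ↦ L ⟫) →
       (P where:= M) ≈ ren id κ (replace z L t′ ((P′ where:= M′) ⟪ z ↦ L ⟫))
  go c with t′ ≟ z
  ... | yes _ = ≈-trans ((≈-trans d (≈-reflexive (cong₂ _where:=_
                  (ren-square {σ′ = lift 1 suc} {τ′ = id} (λ { zero → refl ; (suc x) → refl }) (λ _ → refl) L)
                  (sym (ren-lift-id _))))) where:= c)
                (≈-sym (base (E1 _ _ _)))
  ... | no _  = ≈-trans d (≈-reflexive (sym (ren-lift-id _))) where:= c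

inv-⟪⟫ : {κ : Fin m′ → Fin m} {z : Fin m′} {L : Term (suc n) m′}
         {σ : Subᵗ Γ Δ} {ν : Env Δ n m} {ν′ : Env Γ n m′} →
         (∀ {a} (x : Γ ∋ a) → NameRel κ z L a (inv ν (σ x)) (ν′ x)) →
         (M : Tm Γ a) → SemRel κ z L a (inv ν (subᵗ σ M)) (inv ν′ M)
inv-⟪⟫ {a = a} {ν′ = ν′} e (var x) = SemRel-name a (ν′ x) (e x)
inv-⟪⟫ {ν = ν} {ν′} e (lam rW M) =
  ƛ ≈-trans (inv-⟪⟫ (NameRel-liftW {ν = ν} {ν′} e) M) (≈-reflexive (sym (ren-lift-id _)))
inv-⟪⟫ {ν = ν} {ν′} e (lam rK M) =
  SemRel-lamK _ _ _ (proj₂ (inv (liftW ν′) M)) (inv-⟪⟫ (NameRel-liftW {ν = ν} {ν′} e) M)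
inv-⟪⟫ {κ = κ} {z} {L} {σ = σ} {ν} {ν′} e (lam rT M) with inv-⟪⟫ (NameRel-liftK {ν = ν} {ν′} e) M
... | e₁ , d = ≈-trans
  (≈-trans (≈-reflexive (cong (λ k → mu k (proj₂ (inv (liftK ν) (subᵗ (extsᵗ σ) M)))) e₁))
    (mu-≈ (lift 1 κ t) d))
  (≈-reflexive (trans (sym (mu-ren t _)) (cong (ren id κ) (sym (mu-⟪⟫ t _)))))
  where
  t = proj₁ (inv (liftK ν′) M)
inv-⟪⟫ e (app rW M N) = inv-⟪⟫ e M · inv-⟪⟫ e N
inv-⟪⟫ e (app rK M N) with inv-⟪⟫ e M
... | e₁ , h = e₁ , h (inv-⟪⟫ e N)
inv-⟪⟫ e (app rT M N) with inv-⟪⟫ e N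
... | e₁ , h = e₁ , h (inv-⟪⟫ e M)

-- Substitution of `[ t ] (L where:= □)` for the bound variable splits into the replacement of βμ at
-- `zero` and the renaming of `zero` to `t`, which is that of βj.
inv-[]ᴷ : {ν : Env Γ n m} (M : Tm (K ∷ Γ) Q) (N : Tm (W ∷ Γ) Q) →
          let t = proj₁ (inv (liftW ν) N) ; L = wkᶜ (proj₂ (inv (liftW ν) N)) in
          SemRel (point t) zero L Q (inv ν (M [ lam rK N ])) (inv (liftK ν) M)
inv-[]ᴷ {ν = ν} M N = inv-⟪⟫ {ν = ν} {ν′ = liftK ν} (λ
  { ze → cong (λ L → proj₁ (inv (liftW ν) N) , just L) (sym (ren-point-wkᶜ _))
  ; (su {W} x) → refl ; (su {K} x) → refl
  ; (su {T} x) → ⊥-elim (ν x) ; (su {Q} x) → ⊥-elim (ν x) }) M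

inv-[var] : {ν : Env Γ n m} (M : Tm (K ∷ Γ) Q) (k : Γ ∋ K) →
            inv ν (M [ var k ]) ≡ renSem id (point (ν k)) Q (inv (liftK ν) M)
inv-[var] {Γ = Γ} {ν = ν} M k = trans (cong (inv ν) (subᵗ-var {ρ = ρ} (λ { ze → refl ; (su x) → refl }) M))
  (trans (inv-renᵗ {ν′ = λ x → ν (ρ x)} (λ _ → refl) M) (sym (ren-inv {ν = liftK ν} (λ
    { ze → refl ; (su {W} x) → refl ; (su {K} x) → refl
    ; (su {T} x) → ⊥-elim (ν x) ; (su {Q} x) → ⊥-elim (ν x) }) M)))
  where
  ρ : Renᵗ (K ∷ Γ) Γ
  ρ ze     = k
  ρ (su x) = x

-- The inverse translation preserves reduction

-- If `mu t M` is contracted, the bound variable occurs only at the head of the jump, and both sides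
-- are already equal; otherwise βμ applies, followed by ημ in case the reduct is a redex for it.
where-mu : (L : Term (suc n) m) (t : Fin (suc m)) (M : Term n (suc m)) →
           (L where:= mu t M) ⟶* mu t (replace zero (wkᶜ L) t (M ⟪ zero ↦ wkᶜ L ⟫))
where-mu L t M with mu t M | muView t M
... | .M₀ | lin M₀ = ⟶*-reflexive (sym (trans (cong (mu zero) (trans
        (cong (wkᶜ L where:=_) (⟪⟫-∉ (wkᶜ M₀) (zero∉wkᶜ M₀))) (sym (wkᶜ-where L M₀)))) (mu-lin _)))
... | ._ | non h with ↦⇒⟶* (βμ {M = L} {J = [ t ] M})
-- Both the replacement on `[ t ] M` and `replace` compute only once this is decided.
... | d with t ≟ zero
... | yes _ = ⟶*-trans d (μ⟶*mu t _)
... | no _  = ⟶*-trans d (μ⟶*mu t _)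

-- Kind K is compared after plugging: η can turn `just _` into `nothing`, which no reduction between
-- terms expresses.
RedRel : ∀ a → Sem a n m → Sem a n m → Set
RedRel W M M′ = M ⟶* M′
RedRel K (t , C) (t′ , C′) = ∀ M → (t , plug C M) ⇝ (t′ , plug C′ M)
RedRel T M M′ = M ⟶* M′
RedRel Q S S′ = S ⇝ S′

⟶*-plug : (C : Maybe (Term (suc n) m)) {M M′ : Term n m} → M ⟶* M′ → plug C M ⟶* plug C M′
⟶*-plug nothing  d = d
⟶*-plug (just L) d = ⟶*-where (done ≈-refl) d

RedRel-ηᴷ : (S : Sem K n m) →
  RedRel K (proj₁ S , just (plug (proj₂ (renSem suc id K S)) (var zero))) S
RedRel-ηᴷ (t , nothing) M = ⟶*⇒⇝ (↦⇒⟶* ηw)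
-- E1 from right to left isolates `var zero where:= M`, an ηw-redex.
RedRel-ηᴷ (t , just L)  M = ⟶*⇒⇝ (≈-⟶* (≈-sym (base (E1 L (var zero) M))) (⟶*-where (done ≈-refl) (↦⇒⟶* ηw)))

-- Applied to a variable, the redex is a jump to a μ, and its βj is already accounted for by the
-- definition of `⇝`. Applied to an abstraction, it is a `where` over a μ, and βμ does the
-- replacement while `⇝` supplies the renaming.
RedRel-βᵀ : {ν : Env Γ n m} (M : Tm (K ∷ Γ) Q) (N : Tm Γ K) →
            inv ν (app rT (lam rT M) N) ⇝ inv ν (M [ N ])
RedRel-βᵀ {ν = ν} M (var k) =
  subst (inv ν (app rT (lam rT M) (var k)) ⇝_) (sym (inv-[var] {ν = ν} M k))
    (proj₁ (inv (liftK ν) M) , _ , done ≈-refl , refl , ≈-refl)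
RedRel-βᵀ {ν = ν} M (lam rK N) with inv-[]ᴷ {ν = ν} M N
... | e , d = proj₁ (inv (liftK ν) M) , _ , where-mu _ (proj₁ (inv (liftK ν) M)) _ , sym e , ≈-sym d

inv-⟶ᵗ : {M M′ : Tm Γ a} → M ⟶ᵗ M′ → (ν : Env Γ n m) → RedRel a (inv ν M) (inv ν M′)
inv-⟶ᵗ (lam {r = rW} d) ν  = ⟶*-ƛ (inv-⟶ᵗ d (liftW ν))
inv-⟶ᵗ (lam {r = rK} d) ν  = λ M → ⇝-where (inv-⟶ᵗ d (liftW ν))
inv-⟶ᵗ (lam {r = rT} d) ν  = ⇝-mu (inv-⟶ᵗ d (liftK ν))
inv-⟶ᵗ (appˡ {r = rW} d) ν = ⟶*-· (inv-⟶ᵗ d ν) (done ≈-refl)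
inv-⟶ᵗ (appˡ {r = rK} d) ν = inv-⟶ᵗ d ν _
inv-⟶ᵗ (appˡ {r = rT} {N = N} d) ν = ⟶*⇒⇝ (⟶*-plug (proj₂ (inv ν N)) (inv-⟶ᵗ d ν))
inv-⟶ᵗ (appʳ {r = rW} d) ν = ⟶*-· (done ≈-refl) (inv-⟶ᵗ d ν)
inv-⟶ᵗ (appʳ {r = rK} {M = M} d) ν = ⟶*⇒⇝ (⟶*-plug (proj₂ (inv ν M)) (inv-⟶ᵗ d ν))
inv-⟶ᵗ (appʳ {r = rT} d) ν = inv-⟶ᵗ d ν _
inv-⟶ᵗ (β {r = rW} M N) ν  = ⟶*-trans (↦⇒⟶* (βλ (inv-value N))) (⟶*-trans (↦⇒⟶* (βw (inv-value N)))
  (⟶*-reflexive (sym (inv-[]ᵀ M N))))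
inv-⟶ᵗ (β {r = rK} M N) ν  =
  subst (inv ν (app rK (lam rK M) N) ⇝_) (sym (inv-[]ᑫ M N)) (⟶*⇒⇝ (↦⇒⟶* (βw (inv-value N))))
inv-⟶ᵗ (β {r = rT} M N) ν  = RedRel-βᵀ {ν = ν} M N
inv-⟶ᵗ (η rW M) ν = ⟶*-trans
  (⟶*-reflexive (cong (λ z → ƛ (z · var zero)) (inv-liftW-wkᵗ M))) (↦⇒⟶* (ηλ (inv-value M)))
inv-⟶ᵗ (η rK M) ν = subst (λ S → RedRel K (proj₁ S , just (plug (proj₂ S) (var zero))) (inv ν M))
  (sym (inv-liftW-wkᵗ M)) (RedRel-ηᴷ (inv ν M))
-- No step is left to make: this η is the ημ that `mu` has performed.
inv-⟶ᵗ (η rT M) ν = ⟶*-reflexive (trans (cong (mu zero) (inv-liftK-wkᵗ M)) (mu-lin _))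

inv-⟶ᵗ* : {M M′ : Tm Γ T} → M ⟶ᵗ* M′ → (ν : Env Γ n m) → inv ν M ⟶* inv ν M′
inv-⟶ᵗ* ε        ν = done ≈-refl
inv-⟶ᵗ* (d ◅ ds) ν = ⟶*-trans (inv-⟶ᵗ d ν) (inv-⟶ᵗ* ds ν)

inv-⇛* : {M M′ : Tm Γ T} → M ⇛* M′ → (ν : Env Γ n m) → inv ν M ⟶* inv ν M′
inv-⇛* ε        ν = done ≈-refl
inv-⇛* (d ◅ ds) ν = ⟶*-trans (inv-⟶ᵗ* (⇛⇒⟶ᵗ* d) ν) (inv-⇛* ds ν)

-- The CPS translation

ret : Tm Γ W → Tm Γ T
ret V = lam rT (app rK (var ze) (wkᵗ V))

Let : Tm Γ T → Tm (W ∷ Γ) T → Tm Γ T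
Let A B = lam rT (app rT (wkᵗ A) (lam rK (app rT (renᵗ (extᵗ su) B) (var (su ze)))))

-- Value operands must be recognised: naming one by a `where` would require M ⟶* inv (tr M) to run
-- βw backwards. `appV` and `appR` therefore name only non-values, in the order of ad₁ and ad₂.
data Res (Γ : Cx) : Set where
  val : Tm Γ W → Res Γ
  cmp : Tm Γ T → Res Γ

⌊_⌋ : Res Γ → Tm Γ T
⌊ val V ⌋ = ret V
⌊ cmp A ⌋ = A

renRes : Renᵗ Γ Δ → Res Γ → Res Δ
renRes ρ (val V) = val (renᵗ ρ V)
renRes ρ (cmp A) = cmp (renᵗ ρ A)

subRes : Subᵗ Γ Δ → Res Γ → Res Δ
subRes σ (val V) = val (subᵗ σ V)
subRes σ (cmp A) = cmp (subᵗ σ A)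

appV : Tm Γ W → Res Γ → Tm Γ T
appV V (val V′) = app rW V V′
appV V (cmp B)  = Let B (app rW (wkᵗ V) (var ze))

appR : Res Γ → Res Γ → Tm Γ T
appR (val V) r = appV V r
appR (cmp A) r = Let A (appV (var ze) (renRes su r))

TEnv : ℕ → ℕ → Cx → Set
TEnv n m Γ = ∀ a → Name a n m → Tm Γ a

extW : TEnv n m Γ → TEnv (suc n) m (W ∷ Γ)
extW θ W zero    = var ze
extW θ W (suc x) = wkᵗ (θ W x)
extW θ K k       = wkᵗ (θ K k)

extK : TEnv n m Γ → TEnv n (suc m) (K ∷ Γ)
extK θ W x       = wkᵗ (θ W x)
extK θ K zero    = var ze
extK θ K (suc k) = wkᵗ (θ K k)

Out : Sort → Cx → Set
Out trm Γ = Res Γ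
Out jmp Γ = Tm Γ Q

tr : TEnv n m Γ → Exp s n m → Out s Γ
tr θ (var x)       = val (θ W x)
tr θ (ƛ M)         = val (lam rW ⌊ tr (extW θ) M ⌋)
tr θ (M · N)       = cmp (appR (tr θ M) (tr θ N))
tr {s = trm} θ (L where:= M) = cmp (Let ⌊ tr θ M ⌋ ⌊ tr (extW θ) L ⌋)
tr {s = jmp} θ (J where:= M) = app rT ⌊ tr θ M ⌋ (lam rK (tr (extW θ) J))
tr θ (μ J)         = cmp (lam rT (tr (extK θ) J))
tr θ ([ k ] M)     = app rT ⌊ tr θ M ⌋ (θ K k)

-- Renaming and substitution under the CPS translation

ret-renᵗ : {ρ : Renᵗ Γ Δ} (V : Tm Γ W) → renᵗ ρ (ret V) ≡ ret (renᵗ ρ V)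
ret-renᵗ V = cong (λ z → lam rT (app rK (var ze) z)) (wkᵗ-renᵗ V)

ret-subᵗ : {σ : Subᵗ Γ Δ} (V : Tm Γ W) → subᵗ σ (ret V) ≡ ret (subᵗ σ V)
ret-subᵗ V = cong (λ z → lam rT (app rK (var ze) z)) (wkᵗ-subᵗ V)

Let-renᵗ : {ρ : Renᵗ Γ Δ} (A : Tm Γ T) (B : Tm (W ∷ Γ) T) →
           renᵗ ρ (Let A B) ≡ Let (renᵗ ρ A) (renᵗ (extᵗ ρ) B)
Let-renᵗ A B = cong₂ (λ y z → lam rT (app rT y (lam rK (app rT z (var (su ze)))))) (wkᵗ-renᵗ A)
  (trans (renᵗ-renᵗ (λ { ze → refl ; (su x) → refl }) B) (sym (renᵗ-renᵗ (λ _ → refl) B)))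

Let-subᵗ : {σ : Subᵗ Γ Δ} (A : Tm Γ T) (B : Tm (W ∷ Γ) T) →
           subᵗ σ (Let A B) ≡ Let (subᵗ σ A) (subᵗ (extsᵗ σ) B)
Let-subᵗ {σ = σ} A B = cong₂ (λ y z → lam rT (app rT y (lam rK (app rT z (var (su ze)))))) (wkᵗ-subᵗ A)
  (trans (subᵗ-renᵗ (λ _ → refl) B)
    (sym (renᵗ-subᵗ (λ { ze → refl ; (su x) → wkᵗ-renᵗ (σ x) }) B)))

⌊⌋-renᵗ : {ρ : Renᵗ Γ Δ} (r : Res Γ) → ⌊ renRes ρ r ⌋ ≡ renᵗ ρ ⌊ r ⌋
⌊⌋-renᵗ (val V) = sym (ret-renᵗ V)
⌊⌋-renᵗ (cmp A) = refl

⌊⌋-subᵗ : {σ : Subᵗ Γ Δ} (r : Res Γ) → ⌊ subRes σ r ⌋ ≡ subᵗ σ ⌊ r ⌋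
⌊⌋-subᵗ (val V) = sym (ret-subᵗ V)
⌊⌋-subᵗ (cmp A) = refl

appV-subᵗ : {σ : Subᵗ Γ Δ} (V : Tm Γ W) (r : Res Γ) → subᵗ σ (appV V r) ≡ appV (subᵗ σ V) (subRes σ r)
appV-subᵗ V (val V′) = refl
appV-subᵗ V (cmp B)  =
  trans (Let-subᵗ B (app rW (wkᵗ V) (var ze))) (cong (λ z → Let _ (app rW z (var ze))) (wkᵗ-subᵗ V))

wk-subRes : {σ : Subᵗ Γ Δ} (r : Res Γ) → subRes (extsᵗ {u = u} σ) (renRes su r) ≡ renRes su (subRes σ r)
wk-subRes (val V) = cong val (wkᵗ-subᵗ V)
wk-subRes (cmp A) = cong cmp (wkᵗ-subᵗ A)

appR-subᵗ : {σ : Subᵗ Γ Δ} (q r : Res Γ) → subᵗ σ (appR q r) ≡ appR (subRes σ q) (subRes σ r)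
appR-subᵗ (val V) r = appV-subᵗ V r
appR-subᵗ (cmp A) r = trans (Let-subᵗ A (appV (var ze) (renRes su r)))
  (cong (Let _) (trans (appV-subᵗ (var ze) (renRes su r)) (cong (appV (var ze)) (wk-subRes r))))

subOut : ∀ s → Subᵗ Γ Δ → Out s Γ → Out s Δ
subOut trm σ r = subRes σ r
subOut jmp σ J = subᵗ σ J

renOut : ∀ s → Renᵗ Γ Δ → Out s Γ → Out s Δ
renOut trm ρ r = renRes ρ r
renOut jmp ρ J = renᵗ ρ J

extW-subᵗ : {σ : Subᵗ Γ Δ} {θ : TEnv n m Γ} {θ′ : TEnv n m Δ} →
            (∀ a x → subᵗ σ (θ a x) ≡ θ′ a x) → ∀ a x → subᵗ (extsᵗ σ) (extW θ a x) ≡ extW θ′ a x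
extW-subᵗ e W zero = refl
extW-subᵗ {θ = θ} e W (suc x) = trans (wkᵗ-subᵗ (θ W x)) (cong wkᵗ (e W x))
extW-subᵗ {θ = θ} e K k       = trans (wkᵗ-subᵗ (θ K k)) (cong wkᵗ (e K k))

extK-subᵗ : {σ : Subᵗ Γ Δ} {θ : TEnv n m Γ} {θ′ : TEnv n m Δ} →
            (∀ a x → subᵗ σ (θ a x) ≡ θ′ a x) → ∀ a x → subᵗ (extsᵗ σ) (extK θ a x) ≡ extK θ′ a x
extK-subᵗ {θ = θ} e W x = trans (wkᵗ-subᵗ (θ W x)) (cong wkᵗ (e W x))
extK-subᵗ e K zero = refl
extK-subᵗ {θ = θ} e K (suc k) = trans (wkᵗ-subᵗ (θ K k)) (cong wkᵗ (e K k))

subᵗ-tr : {σ : Subᵗ Γ Δ} {θ : TEnv n m Γ} {θ′ : TEnv n m Δ} →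
          (∀ a x → subᵗ σ (θ a x) ≡ θ′ a x) →
          (M : Exp s n m) → subOut s σ (tr θ M) ≡ tr θ′ M
⌊subᵗ-tr⌋ : {σ : Subᵗ Γ Δ} {θ : TEnv n m Γ} {θ′ : TEnv n m Δ} →
          (∀ a x → subᵗ σ (θ a x) ≡ θ′ a x) →
          (M : Term n m) → subᵗ σ ⌊ tr θ M ⌋ ≡ ⌊ tr θ′ M ⌋
⌊subᵗ-tr⌋ {θ = θ} e M = trans (sym (⌊⌋-subᵗ (tr θ M))) (cong ⌊_⌋ (subᵗ-tr e M))
subᵗ-tr e (var x) = cong val (e W x)
subᵗ-tr e (ƛ M)   = cong (λ z → val (lam rW z)) (⌊subᵗ-tr⌋ (extW-subᵗ e) M)
subᵗ-tr {θ = θ} e (M · N) = cong cmp (trans (appR-subᵗ (tr θ M) _) (cong₂ appR (subᵗ-tr e M) (subᵗ-tr e N)))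
subᵗ-tr {s = trm} {θ = θ} e (L where:= M) = cong cmp (trans (Let-subᵗ ⌊ tr θ M ⌋ ⌊ tr (extW θ) L ⌋)
  (cong₂ Let (⌊subᵗ-tr⌋ e M) (⌊subᵗ-tr⌋ (extW-subᵗ e) L)))
subᵗ-tr {s = jmp} e (J where:= M) =
  cong₂ (λ y z → app rT y (lam rK z)) (⌊subᵗ-tr⌋ e M) (subᵗ-tr (extW-subᵗ e) J)
subᵗ-tr e (μ J)     = cong (λ z → cmp (lam rT z)) (subᵗ-tr (extK-subᵗ e) J)
subᵗ-tr e ([ k ] M) = cong₂ (app rT) (⌊subᵗ-tr⌋ e M) (e K k)

extW-ren : {f : Fin n → Fin n′} {g : Fin m → Fin m′} {θ : TEnv n′ m′ Γ} {θ′ : TEnv n m Γ} →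
           (∀ a x → θ a (renName f g a x) ≡ θ′ a x) →
           ∀ a x → extW θ a (renName (lift 1 f) g a x) ≡ extW θ′ a x
extW-ren e W zero    = refl
extW-ren e W (suc x) = cong wkᵗ (e W x)
extW-ren e K k       = cong wkᵗ (e K k)

extK-ren : {f : Fin n → Fin n′} {g : Fin m → Fin m′} {θ : TEnv n′ m′ Γ} {θ′ : TEnv n m Γ} →
           (∀ a x → θ a (renName f g a x) ≡ θ′ a x) →
           ∀ a x → extK θ a (renName f (lift 1 g) a x) ≡ extK θ′ a x
extK-ren e W x       = cong wkᵗ (e W x)
extK-ren e K zero    = refl
extK-ren e K (suc k) = cong wkᵗ (e K k)

tr-ren : {f : Fin n → Fin n′} {g : Fin m → Fin m′} {θ : TEnv n′ m′ Γ} {θ′ : TEnv n m Γ} →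
         (∀ a x → θ a (renName f g a x) ≡ θ′ a x) →
         (M : Exp s n m) → tr θ (ren f g M) ≡ tr θ′ M
tr-ren e (var x) = cong val (e W x)
tr-ren e (ƛ M)   = cong (λ z → val (lam rW ⌊ z ⌋)) (tr-ren (extW-ren e) M)
tr-ren e (M · N) = cong₂ (λ q r → cmp (appR q r)) (tr-ren e M) (tr-ren e N)
tr-ren {s = trm} e (L where:= M) = cong₂ (λ y z → cmp (Let ⌊ y ⌋ ⌊ z ⌋)) (tr-ren e M) (tr-ren (extW-ren e) L)
tr-ren {s = jmp} e (J where:= M) = cong₂ (λ y z → app rT ⌊ y ⌋ (lam rK z)) (tr-ren e M) (tr-ren (extW-ren e) J)
tr-ren e (μ J)     = cong (λ z → cmp (lam rT z)) (tr-ren (extK-ren e) J)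
tr-ren e ([ k ] M) = cong₂ (λ y z → app rT ⌊ y ⌋ z) (tr-ren e M) (e K k)

renOut-subOut : ∀ s (ρ : Renᵗ Γ Δ) (o : Out s Γ) → renOut s ρ o ≡ subOut s (λ x → var (ρ x)) o
renOut-subOut trm ρ (val V) = cong val (sym (subᵗ-var (λ _ → refl) V))
renOut-subOut trm ρ (cmp A) = cong cmp (sym (subᵗ-var (λ _ → refl) A))
renOut-subOut jmp ρ J       = sym (subᵗ-var (λ _ → refl) J)

renᵗ-tr : {ρ : Renᵗ Γ Δ} {f : Fin n → Fin n′} {g : Fin m → Fin m′} {θ : TEnv n m Γ} {θ′ : TEnv n′ m′ Δ} →
          (∀ a x → renᵗ ρ (θ a x) ≡ θ′ a (renName f g a x)) →
          (M : Exp s n m) → renOut s ρ (tr θ M) ≡ tr θ′ (ren f g M)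
renᵗ-tr {s = s} {ρ = ρ} {f} {g} {θ} {θ′} e M = trans (renOut-subOut s ρ (tr θ M))
  (trans (subᵗ-tr {θ′ = λ a x → θ′ a (renName f g a x)} (λ a x → trans (subᵗ-var (λ _ → refl) (θ a x)) (e a x)) M)
    (sym (tr-ren (λ _ _ → refl) M)))

⌊renᵗ-tr⌋ : {ρ : Renᵗ Γ Δ} {f : Fin n → Fin n′} {g : Fin m → Fin m′} {θ : TEnv n m Γ} {θ′ : TEnv n′ m′ Δ} →
            (∀ a x → renᵗ ρ (θ a x) ≡ θ′ a (renName f g a x)) →
            (M : Term n m) → renᵗ ρ ⌊ tr θ M ⌋ ≡ ⌊ tr θ′ (ren f g M) ⌋
⌊renᵗ-tr⌋ {θ = θ} e M = trans (sym (⌊⌋-renᵗ (tr θ M))) (cong ⌊_⌋ (renᵗ-tr e M))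

tr-wk : {θ : TEnv n m Γ} (M : Exp s n m) → renOut s su (tr θ M) ≡ tr (extW θ) (wk M)
tr-wk = renᵗ-tr (λ { W x → refl ; K k → refl })

tr-wkᶜ : {θ : TEnv n m Γ} (M : Exp s n m) → renOut s su (tr θ M) ≡ tr (extK θ) (wkᶜ M)
tr-wkᶜ = renᵗ-tr (λ { W x → refl ; K k → refl })

⌊tr-wkᶜ⌋ : {θ : TEnv n m Γ} (M : Term n m) → wkᵗ ⌊ tr θ M ⌋ ≡ ⌊ tr (extK θ) (wkᶜ M) ⌋
⌊tr-wkᶜ⌋ = ⌊renᵗ-tr⌋ (λ { W x → refl ; K k → refl })

extW-sub : {θ : TEnv n m Γ} {θ′ : TEnv n′ m Γ} {σ : Fin n′ → Term n m} →
           (∀ x → tr θ (σ x) ≡ val (θ′ W x)) → ∀ x → tr (extW θ) (exts σ x) ≡ val (extW θ′ W x)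
extW-sub e zero = refl
extW-sub {σ = σ} e (suc x) = trans (sym (tr-wk (σ x))) (cong (renRes su) (e x))

extK-sub : {θ : TEnv n m Γ} {θ′ : TEnv n′ m Γ} {σ : Fin n′ → Term n m} →
           (∀ x → tr θ (σ x) ≡ val (θ′ W x)) → ∀ x → tr (extK θ) (wkᶜ (σ x)) ≡ val (extK θ′ W x)
extK-sub {σ = σ} e x = trans (sym (tr-wkᶜ (σ x))) (cong (renRes su) (e x))

tr-sub : {θ : TEnv n m Γ} {θ′ : TEnv n′ m Γ} {σ : Fin n′ → Term n m} →
         (∀ x → tr θ (σ x) ≡ val (θ′ W x)) → (∀ k → θ K k ≡ θ′ K k) →
         (M : Exp s n′ m) → tr θ (sub σ M) ≡ tr θ′ M
tr-sub e f (var x) = e x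
tr-sub e f (ƛ M)   = cong (λ z → val (lam rW ⌊ z ⌋)) (tr-sub (extW-sub e) (cong wkᵗ ∘ f) M)
tr-sub e f (M · N) = cong₂ (λ q r → cmp (appR q r)) (tr-sub e f M) (tr-sub e f N)
tr-sub {s = trm} e f (L where:= M) =
  cong₂ (λ y z → cmp (Let ⌊ y ⌋ ⌊ z ⌋)) (tr-sub e f M) (tr-sub (extW-sub e) (cong wkᵗ ∘ f) L)
tr-sub {s = jmp} e f (J where:= M) =
  cong₂ (λ y z → app rT ⌊ y ⌋ (lam rK z)) (tr-sub e f M) (tr-sub (extW-sub e) (cong wkᵗ ∘ f) J)
tr-sub {θ′ = θ′} e f (μ J) = cong (λ z → cmp (lam rT z))
  (tr-sub (extK-sub {θ′ = θ′} e) (λ { zero → refl ; (suc k) → cong wkᵗ (f k) }) J)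
tr-sub e f ([ k ] M) = cong₂ (λ y z → app rT ⌊ y ⌋ z) (tr-sub e f M) (f k)

-- Equational theory of the monadic operations

app-ret : (V : Tm Γ W) (C : Tm Γ K) → app rT (ret V) C ≃ app rK C V
app-ret V C = ≃-trans (≃-β _ C) (≃-reflexive (cong (app rK C) (wkᵗ-[] V)))

app-Let : (A : Tm Γ T) (B : Tm (W ∷ Γ) T) (C : Tm Γ K) →
          app rT (Let A B) C ≃ app rT A (lam rK (app rT B (wkᵗ C)))
app-Let A B C = ≃-trans (≃-β _ C) (≃-reflexive (cong₂ (λ y z → app rT y (lam rK (app rT z (wkᵗ C))))
  (wkᵗ-[] A) (trans (subᵗ-renᵗ {τ = var} (λ { ze → refl ; (su x) → refl }) B)
    (trans (subᵗ-var (λ _ → refl) B) (renᵗ-id (λ _ → refl) B)))))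

≃-Let : {A A′ : Tm Γ T} {B B′ : Tm (W ∷ Γ) T} → A ≃ A′ → B ≃ B′ → Let A B ≃ Let A′ B′
≃-Let p q = ≃-lam (≃-app (≃-renᵗ su p) (≃-lam (≃-app (≃-renᵗ (extᵗ su) q) ≃-refl)))

≃-ret : {V V′ : Tm Γ W} → V ≃ V′ → ret V ≃ ret V′
≃-ret p = ≃-lam (≃-app ≃-refl (≃-renᵗ su p))

Let-ret : (V : Tm Γ W) (B : Tm (W ∷ Γ) T) → Let (ret V) B ≃ B [ V ]
Let-ret V B = ≃-trans (≃-lam (≃-trans (≃-app (≃-reflexive (ret-renᵗ V)) ≃-refl)
  (≃-trans (app-ret _ _) (≃-trans (≃-β _ _)
    (≃-app (≃-reflexive (sym (renᵗ-[] B))) ≃-refl))))) (≃-η _)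

-- The monad law that interprets E1.
Let-assoc : (A : Tm Γ T) (B C : Tm (W ∷ Γ) T) →
            Let (Let A B) C ≃ Let A (Let B (renᵗ (extᵗ su) C))
Let-assoc A B C = ≃-lam (≃-trans (≃-app (≃-reflexive (Let-renᵗ A B)) ≃-refl) (≃-trans (app-Let _ _ _)
  (≃-app ≃-refl (≃-lam (≃-trans
    (≃-app ≃-refl (≃-lam (≃-app (≃-reflexive
      (trans (renᵗ-renᵗ {ρ″ = ρ″} (λ { ze → refl ; (su x) → refl }) C)
        (sym (renᵗ-renᵗ (λ { ze → refl ; (su x) → refl }) C)))) ≃-refl)))
    (≃-trans (≃-sym (app-Let _ _ _)) (≃-app (≃-reflexive (sym (Let-renᵗ B _))) ≃-refl)))))))
  where
  ρ″ : Renᵗ (W ∷ Γ) (W ∷ W ∷ K ∷ Γ)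
  ρ″ ze     = ze
  ρ″ (su x) = su (su (su x))

appV-Let : (V : Tm Γ W) (r : Res Γ) → appV V r ≃ Let ⌊ r ⌋ (app rW (wkᵗ V) (var ze))
appV-Let V (val V′) = ≃-sym (≃-trans (Let-ret V′ _) (≃-reflexive (cong (λ z → app rW z V′) (wkᵗ-[] V))))
appV-Let V (cmp B)  = ≃-refl

-- The uniform translation of application, which names both operands; unlike `appR` it is visibly
-- compatible with `≃`.
gapp : Tm Γ T → Tm Γ T → Tm Γ T
gapp A B = Let A (Let (wkᵗ B) (app rW (var (su ze)) (var ze)))

-- The translation of an application distinguishes values from non-values, but
-- the distinction is invisible up to βη.
appR-gapp : (q r : Res Γ) → appR q r ≃ gapp ⌊ q ⌋ ⌊ r ⌋
appR-gapp (val V) r = ≃-trans (appV-Let V r) (≃-sym (≃-trans (Let-ret V _)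
  (≃-reflexive (trans (Let-subᵗ (wkᵗ ⌊ r ⌋) (app rW (var (su ze)) (var ze)))
    (cong (λ z → Let z (app rW (wkᵗ V) (var ze))) (wkᵗ-[] ⌊ r ⌋))))))
appR-gapp (cmp A) r = ≃-Let ≃-refl (≃-trans (appV-Let (var ze) (renRes su r))
  (≃-reflexive (cong (λ z → Let z (app rW (var (su ze)) (var ze))) (⌊⌋-renᵗ r))))

≃-appR : (q q′ r r′ : Res Γ) → ⌊ q ⌋ ≃ ⌊ q′ ⌋ → ⌊ r ⌋ ≃ ⌊ r′ ⌋ → appR q r ≃ appR q′ r′
≃-appR q q′ r r′ d e = ≃-trans (appR-gapp q r) (≃-trans
  (≃-Let d (≃-Let (≃-renᵗ su e) ≃-refl)) (≃-sym (appR-gapp q′ r′)))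

_≃ᵒ_ : Out s Γ → Out s Γ → Set
_≃ᵒ_ {trm} q r = ⌊ q ⌋ ≃ ⌊ r ⌋
_≃ᵒ_ {jmp} I J = I ≃ J

≃ᵒ-refl : ∀ s {o : Out s Γ} → _≃ᵒ_ {s} o o
≃ᵒ-refl trm = ≃-refl
≃ᵒ-refl jmp = ≃-refl

≃ᵒ-sym : ∀ s {o p : Out s Γ} → _≃ᵒ_ {s} o p → _≃ᵒ_ {s} p o
≃ᵒ-sym trm = ≃-sym
≃ᵒ-sym jmp = ≃-sym

≃ᵒ-trans : ∀ s {o p q : Out s Γ} → _≃ᵒ_ {s} o p → _≃ᵒ_ {s} p q → _≃ᵒ_ {s} o q
≃ᵒ-trans trm = ≃-trans
≃ᵒ-trans jmp = ≃-trans

-- Structural replacement at `k` seen through CPS: `θ′` sends `k` to the continuation that runs `M`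
-- on its argument with the old `θ K k` as continuation. It is a relation because `extW` and `extK`
-- preserve such an update only pointwise.
record Updates (θ θ′ : TEnv n m Γ) (k : Fin m) (M : Term (suc n) m) : Set where
  field
    onW  : ∀ x → θ W x ≡ θ′ W x
    off  : ∀ l → l ≢ k → θ K l ≡ θ′ K l
    on   : θ′ K k ≡ lam rK (app rT ⌊ tr (extW θ) M ⌋ (wkᵗ (θ K k)))

open Updates

Updates-extW : {θ θ′ : TEnv n m Γ} {k : Fin m} {M : Term (suc n) m} →
               Updates θ θ′ k M → Updates (extW θ) (extW θ′) k (wk₁ M)
Updates-extW e .onW zero    = refl
Updates-extW e .onW (suc x) = cong wkᵗ (e .onW x)
Updates-extW e .off l ¬p    = cong wkᵗ (e .off l ¬p)
Updates-extW {θ = θ} {k = k} {M} e .on = trans (cong wkᵗ (e .on)) (cong₂ (λ y z → lam rK (app rT y z))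
  (⌊renᵗ-tr⌋ (λ { W zero → refl ; W (suc x) → wkᵗ-renᵗ (θ W x) ; K l → wkᵗ-renᵗ (θ K l) }) M)
  (wkᵗ-renᵗ (θ K k)))

Updates-extK : {θ θ′ : TEnv n m Γ} {k : Fin m} {M : Term (suc n) m} →
               Updates θ θ′ k M → Updates (extK θ) (extK θ′) (suc k) (wkᶜ M)
Updates-extK e .onW x          = cong wkᵗ (e .onW x)
Updates-extK e .off zero ¬p    = refl
Updates-extK e .off (suc l) ¬p = cong wkᵗ (e .off l (¬p ∘ cong suc))
Updates-extK {θ = θ} {k = k} {M} e .on = trans (cong wkᵗ (e .on)) (cong₂ (λ y z → lam rK (app rT y z))
  (⌊renᵗ-tr⌋ (λ { W zero → refl ; W (suc x) → wkᵗ-renᵗ (θ W x) ; K l → wkᵗ-renᵗ (θ K l) }) M)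
  (wkᵗ-renᵗ (θ K k)))

tr-⟪⟫ : {θ θ′ : TEnv n m Γ} {k : Fin m} {M : Term (suc n) m} → Updates θ θ′ k M →
        (P : Exp s n m) → _≃ᵒ_ {s} (tr θ (P ⟪ k ↦ M ⟫)) (tr θ′ P)
tr-⟪⟫ e (var x) = ≃-reflexive (cong ret (e .onW x))
tr-⟪⟫ e (ƛ P)   = ≃-ret (≃-lam (tr-⟪⟫ (Updates-extW e) P))
tr-⟪⟫ {θ = θ} {θ′} {k} {M} e (P · P′) =
  ≃-appR (tr θ (P ⟪ k ↦ M ⟫)) (tr θ′ P) (tr θ (P′ ⟪ k ↦ M ⟫)) (tr θ′ P′) (tr-⟪⟫ e P) (tr-⟪⟫ e P′)
tr-⟪⟫ {s = trm} e (P where:= R) = ≃-Let (tr-⟪⟫ e R) (tr-⟪⟫ (Updates-extW e) P)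
tr-⟪⟫ {s = jmp} e (P where:= R) = ≃-app (tr-⟪⟫ e R) (≃-lam (tr-⟪⟫ (Updates-extW e) P))
tr-⟪⟫ e (μ J) = ≃-lam (tr-⟪⟫ (Updates-extK e) J)
tr-⟪⟫ {k = k} e ([ l ] R) with l ≟ k
-- `app-Let` turns running `R` before `M` into running `R` with the composed continuation, which is
-- `θ′ K k`.
... | yes refl = ≃-trans (app-Let _ _ _) (≃-app (tr-⟪⟫ e R) (≃-reflexive (sym (e .on))))
... | no ¬p    = ≃-app (tr-⟪⟫ e R) (≃-reflexive (e .off l ¬p))

-- Soundness of the translation

value-tr : {θ : TEnv n m Γ} {V : Term n m} → Value V → ∃[ V′ ] tr θ V ≡ val V′
value-tr (var x) = _ , refl
value-tr (ƛ M)   = _ , refl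

nonvalue-tr : {θ : TEnv n m Γ} (N : Term n m) → NonValue N → ∃[ A ] tr θ N ≡ cmp A
nonvalue-tr (var x)       ¬v = contradiction (var x) ¬v
nonvalue-tr (ƛ M)         ¬v = contradiction (ƛ M) ¬v
nonvalue-tr (M · N)       ¬v = _ , refl
nonvalue-tr (L where:= M) ¬v = _ , refl
nonvalue-tr (μ J)         ¬v = _ , refl

_▸_ : TEnv n m Γ → Tm Γ W → TEnv (suc n) m Γ
(θ ▸ V) W zero    = V
(θ ▸ V) W (suc x) = θ W x
(θ ▸ V) K k       = θ K k

⌊tr-extW⌋-[] : {θ : TEnv n m Γ} (M : Term (suc n) m) (V : Tm Γ W) →
               ⌊ tr (extW θ) M ⌋ [ V ] ≡ ⌊ tr (θ ▸ V) M ⌋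
⌊tr-extW⌋-[] {θ = θ} M V = ⌊subᵗ-tr⌋ (λ
  { W zero → refl ; W (suc x) → wkᵗ-[] (θ W x) ; K k → wkᵗ-[] (θ K k) }) M

sound-≐ : {P P′ : Exp s n m} → P ≐ P′ → (θ : TEnv n m Γ) → _≃ᵒ_ {s} (tr θ P) (tr θ P′)
sound-≐ (E1 L M N) θ = ≃-trans (Let-assoc _ _ _) (≃-Let ≃-refl (≃-Let ≃-refl (≃-reflexive
  (⌊renᵗ-tr⌋ (λ { W zero → refl ; W (suc x) → wkᵗ-renᵗ (θ W x) ; K k → wkᵗ-renᵗ (θ K k) }) L))))
-- The two sides bind the value and the continuation in opposite orders; after the β-step, `τ`
-- exchanges them in the translation of `J`.
sound-≐ (E2 J M) θ = ≃-lam (≃-app (≃-reflexive (⌊tr-wkᶜ⌋ M)) (≃-lam (≃-trans (≃-β _ _) (≃-reflexive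
  (trans (subᵗ-renᵗ {τ = τ} (λ { ze → refl ; (su ze) → refl ; (su (su x)) → refl }) (tr (extK (extW θ)) J))
    (subᵗ-tr (λ
      { W zero → refl
      ; W (suc x) → wk-wk (θ W x)
      ; K zero → refl
      ; K (suc k) → wk-wk (θ K k) }) J))))))
  where
  τ : Subᵗ (K ∷ W ∷ Γ) (W ∷ K ∷ Γ)
  τ ze          = var (su ze)
  τ (su ze)     = var ze
  τ (su (su x)) = var (su (su x))
  wk-wk : (M : Tm Γ a) → subᵗ τ (wkᵗ (wkᵗ M)) ≡ wkᵗ (wkᵗ M)
  wk-wk M = trans (cong (subᵗ τ) (renᵗ-renᵗ (λ _ → refl) M)) (trans (subᵗ-renᵗ (λ _ → refl) M)
    (trans (subᵗ-var (λ _ → refl) M) (sym (renᵗ-renᵗ (λ _ → refl) M))))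
sound-≐ (E3 k L M) θ = app-Let _ _ _

sound-↦ : {P P′ : Exp s n m} → P ↦ P′ → (θ : TEnv n m Γ) → _≃ᵒ_ {s} (tr θ P) (tr θ P′)
sound-↦ (ad₁ {N = N} {M} ¬v) θ with tr θ N | nonvalue-tr {θ = θ} N ¬v
... | .(cmp A) | A , refl = ≃-Let ≃-refl (≃-reflexive (cong (appV (var ze)) (tr-wk M)))
sound-↦ (ad₂ {V = V} {N} v ¬v) θ with value-tr {θ = θ} v | nonvalue-tr {θ = θ} N ¬v
... | V′ , e | A , f rewrite sym (tr-wk {θ = θ} V) | e | f = ≃-refl
sound-↦ (βλ {M = M} {V} v) θ with tr θ V | value-tr {θ = θ} v
... | .(val V′) | V′ , refl = ≃-trans (≃-β _ _) (≃-sym (Let-ret V′ _))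
sound-↦ (βw {M = M} {V} v) θ with value-tr {θ = θ} v
... | V′ , e rewrite e = ≃-trans (Let-ret V′ _) (≃-reflexive (trans (⌊tr-extW⌋-[] M V′)
  (cong ⌊_⌋ (sym (tr-sub (λ { zero → e ; (suc x) → refl }) (λ _ → refl) M)))))
-- The β-step substitutes `C`, which runs `M` and goes on with the outer continuation, for the
-- variable bound by μ. This amounts to translating `J` in `θ′`, an update of `extK θ` at `zero`.
sound-↦ (βμ {M = M} {J}) θ = ≃-lam (≃-trans (≃-β _ _) (≃-trans (≃-reflexive
    (trans (subᵗ-renᵗ {τ = τ} (λ { ze → refl ; (su x) → refl }) (tr (extK θ) J)) (subᵗ-tr {θ′ = θ′} (λ
      { W x → wk-τ (θ W x) ; K zero → refl ; K (suc k) → wk-τ (θ K k) }) J)))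
  (≃-sym (tr-⟪⟫ {θ = extK θ} {θ′} updates J))))
  where
  C = lam rK (app rT (renᵗ (extᵗ su) ⌊ tr (extW θ) M ⌋) (var (su ze)))
  τ : Subᵗ (K ∷ _) (K ∷ _)
  τ ze     = C
  τ (su x) = var (su x)
  θ′ : TEnv _ _ (K ∷ _)
  θ′ W x       = wkᵗ (θ W x)
  θ′ K zero    = C
  θ′ K (suc k) = wkᵗ (θ K k)
  wk-τ : ∀ {a} (M : Tm _ a) → subᵗ τ (wkᵗ M) ≡ wkᵗ M
  wk-τ M = trans (subᵗ-renᵗ (λ _ → refl) M) (subᵗ-var (λ _ → refl) M)
  updates : Updates (extK θ) θ′ zero (wkᶜ M)
  updates .onW x       = refl
  updates .off zero ¬p = contradiction refl ¬p
  updates .off (suc l) ¬p = refl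
  updates .on = cong (λ z → lam rK (app rT z (var (su ze)))) (⌊renᵗ-tr⌋ (λ
    { W zero → refl ; W (suc x) → wkᵗ-renᵗ (θ W x) ; K k → wkᵗ-renᵗ (θ K k) }) M)
sound-↦ (βj {l = l} {J}) θ = ≃-trans (≃-β _ _) (≃-reflexive (trans
  (subᵗ-tr {θ′ = λ a x → θ a (renName id (point l) a x)} (λ
    { W x → wkᵗ-[] (θ W x) ; K zero → refl ; K (suc k) → wkᵗ-[] (θ K k) }) J)
  (trans (sym (tr-ren (λ _ _ → refl) J)) (cong (tr θ) (sym (⟨⟩ᶜ-point J l))))))
sound-↦ (ηλ {V = V} v) θ with value-tr {θ = θ} v
... | V′ , e rewrite sym (tr-wk {θ = θ} V) | e = ≃-ret (≃-η V′)
sound-↦ (ηw {M = M}) θ = ≃-trans (≃-lam (≃-app ≃-refl (≃-trans (≃-lam (app-ret _ _)) (≃-η _)))) (≃-η _)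
sound-↦ (ημ {M = M}) θ = ≃-trans (≃-lam (≃-app (≃-reflexive (sym (⌊tr-wkᶜ⌋ M))) ≃-refl)) (≃-η _)

sound : {P P′ : Exp s n m} → P =ccv P′ → (θ : TEnv n m Γ) → _≃ᵒ_ {s} (tr θ P) (tr θ P′)
sound (base (inj₁ e)) θ = sound-≐ e θ
sound (base (inj₂ d)) θ = sound-↦ d θ
sound {s = s} ≈-refl θ  = ≃ᵒ-refl s
sound {s = s} (≈-sym d) θ = ≃ᵒ-sym s (sound d θ)
sound {s = s} (≈-trans c d) θ = ≃ᵒ-trans s (sound c θ) (sound d θ)
sound (ƛ d) θ = ≃-ret (≃-lam (sound d (extW θ)))
sound (_·_ {M = M} {M′} {N} {N′} c d) θ = ≃-appR (tr θ M) (tr θ M′) (tr θ N) (tr θ N′) (sound c θ) (sound d θ)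
sound {s = trm} (c where:= d) θ = ≃-Let (sound d θ) (sound c (extW θ))
sound {s = jmp} (c where:= d) θ = ≃-app (sound d θ) (≃-lam (sound c (extW θ)))
sound (μ d) θ = ≃-lam (sound d (extK θ))
sound ([ k ] d) θ = ≃-app (sound d θ) ≃-refl

-- Every expression reduces to the inverse of its translation

invRes : Env Γ n m → Res Γ → Term n m
invRes ν (val V) = inv ν V
invRes ν (cmp A) = inv ν A

-- `ret V` is λk. k V, so it depends on `mu` that values come back as values and not as μ k. [ k ]
-- V.
inv-ret : {ν : Env Γ n m} (V : Tm Γ W) → inv ν (ret V) ≡ inv ν V
inv-ret V = trans (cong (mu zero) (inv-liftK-wkᵗ V)) (mu-lin _)

inv-⌊⌋ : {ν : Env Γ n m} (r : Res Γ) → inv ν ⌊ r ⌋ ≡ invRes ν r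
inv-⌊⌋ (val V) = inv-ret V
inv-⌊⌋ (cmp A) = refl

inv-Let : {ν : Env Γ n m} (A : Tm Γ T) (B : Tm (W ∷ Γ) T) →
          inv ν (Let A B) ≡ (inv (liftW ν) B where:= inv ν A)
inv-Let {ν = ν} A B = trans (cong (mu zero) (cong₂ _where:=_
  (trans (inv-renᵗ (λ _ → refl) B) (sym (ren-inv {ρ = lift 1 id} {κ = suc} {ν = liftW ν} (λ
    { ze → refl ; (su {W} x) → refl ; (su {K} x) → refl
    ; (su {T} x) → ⊥-elim (ν x) ; (su {Q} x) → ⊥-elim (ν x) }) B)))
  (inv-liftK-wkᵗ A))) (mu-lin _)

Reaches : ∀ s → Env Γ n m → Exp s n m → Out s Γ → Set
Reaches trm ν M r = M ⟶* invRes ν r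
Reaches jmp ν J o = J ⟶* [ proj₁ (inv ν o) ] proj₂ (inv ν o)

Inverts : Env Γ n′ m′ → TEnv n m Γ → (Fin n → Fin n′) → (Fin m → Fin m′) → Set
Inverts ν θ f g = ∀ a x → inv ν (θ a x) ≡ name a (renName f g a x)

Inverts-liftW : {ν : Env Γ n′ m′} {θ : TEnv n m Γ} {f : Fin n → Fin n′} {g : Fin m → Fin m′} →
                Inverts ν θ f g → Inverts (liftW ν) (extW θ) (lift 1 f) g
Inverts-liftW e W zero = refl
Inverts-liftW {θ = θ} e W (suc x) = trans (inv-liftW-wkᵗ (θ W x)) (cong wk (e W x))
Inverts-liftW {θ = θ} e K k = trans (inv-liftW-wkᵗ (θ K k)) (cong (renSem suc id K) (e K k))

Inverts-liftK : {ν : Env Γ n′ m′} {θ : TEnv n m Γ} {f : Fin n → Fin n′} {g : Fin m → Fin m′} →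
                Inverts ν θ f g → Inverts (liftK ν) (extK θ) f (lift 1 g)
Inverts-liftK {θ = θ} e W x = trans (inv-liftK-wkᵗ (θ W x)) (cong wkᶜ (e W x))
Inverts-liftK e K zero = refl
Inverts-liftK {θ = θ} e K (suc k) = trans (inv-liftK-wkᵗ (θ K k)) (cong (renSem id suc K) (e K k))

Inverts-wk : {ν : Env Γ n′ m′} {θ : TEnv n m Γ} {f : Fin n → Fin n′} {g : Fin m → Fin m′} →
             Inverts ν θ f g → Inverts (liftW ν) (λ a x → wkᵗ (θ a x)) (suc ∘ f) g
Inverts-wk {θ = θ} e W x = trans (inv-liftW-wkᵗ (θ W x)) (cong wk (e W x))
Inverts-wk {θ = θ} e K k = trans (inv-liftW-wkᵗ (θ K k)) (cong (renSem suc id K) (e K k))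

NonValueCmp : Term n m → Res Γ → Set
NonValueCmp M r = ∀ {A} → r ≡ cmp A → NonValue M

tr-nonvalue : {θ : TEnv n m Γ} {f : Fin n → Fin n′} {g : Fin m → Fin m′} (M : Term n m) →
              NonValueCmp (ren f g M) (tr θ M)
tr-nonvalue (M · N)       _ ()
tr-nonvalue (L where:= M) _ ()
tr-nonvalue (μ J)         _ ()

-- The operand is reduced only after ad₂ has named it: a non-value such as μ k. [ k ] x may reduce
-- to a value, to which ad₂ no longer applies.
Reaches-appV : {ν : Env Γ n m} {M N : Term n m} (V : Tm Γ W) (r : Res Γ) →
               M ⟶* inv ν V → N ⟶* invRes ν r → NonValueCmp N r → M · N ⟶* inv ν (appV V r)
Reaches-appV V (val V′) d e h = ⟶*-· d e
Reaches-appV {ν = ν} {N = N} V (cmp B) d e h =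
  ⟶*-trans (⟶*-· d (done ≈-refl)) (⟶*-trans (↦⇒⟶* (ad₂ (inv-value V) (h refl)))
    (⟶*-trans (⟶*-where (done ≈-refl) e) (⟶*-reflexive
      (sym (trans (inv-Let {ν = ν} B (app rW (wkᵗ V) (var ze)))
      (cong (λ z → (z · var zero) where:= inv ν B) (inv-liftW-wkᵗ V)))))))

Reaches-appR : {ν : Env Γ n m} {M N : Term n m} (q r : Res Γ) →
               M ⟶* invRes ν q → N ⟶* invRes ν r → wk N ⟶* invRes (liftW ν) (renRes su r) →
               NonValueCmp M q → NonValueCmp N r → NonValueCmp (wk N) (renRes {Δ = W ∷ _} su r) →
               M · N ⟶* inv ν (appR q r)
Reaches-appR (val V) r d e f g h i = Reaches-appV V r d e h
Reaches-appR {ν = ν} (cmp A) r d e f g h i = ⟶*-trans (↦⇒⟶* (ad₁ (g refl)))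
  (⟶*-trans (⟶*-where (Reaches-appV (var ze) (renRes su r) (done ≈-refl) f i) d)
    (⟶*-reflexive (sym (inv-Let {ν = ν} A (appV (var ze) (renRes su r))))))

-- The renamings `f` and `g` strengthen the induction: after ad₁ the operand is `wk N`, which is not
-- a subterm of `M · N` but is a renaming of one.
reaches : {ν : Env Γ n′ m′} {θ : TEnv n m Γ} {f : Fin n → Fin n′} {g : Fin m → Fin m′} →
          Inverts ν θ f g → (P : Exp s n m) → Reaches s ν (ren f g P) (tr θ P)
⌊reaches⌋ : {ν : Env Γ n′ m′} {θ : TEnv n m Γ} {f : Fin n → Fin n′} {g : Fin m → Fin m′} →
            Inverts ν θ f g → (M : Term n m) → ren f g M ⟶* inv ν ⌊ tr θ M ⌋
⌊reaches⌋ {θ = θ} e M = ⟶*-trans (reaches e M) (⟶*-reflexive (sym (inv-⌊⌋ (tr θ M))))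
reaches e (var x) = ⟶*-reflexive (sym (e W x))
reaches {ν = ν} {θ} e (ƛ M) = ⟶*-ƛ (⌊reaches⌋ (Inverts-liftW {ν = ν} {θ} e) M)
reaches {ν = ν} {θ} {f} {g} e (M · N) = Reaches-appR {ν = ν} (tr θ M) (tr θ N) (reaches e M) (reaches e N)
  (subst₂ (λ P r → P ⟶* invRes (liftW ν) r) (sym (ren-ren (λ _ → refl) (λ _ → refl) N)) (sym wk-tr)
    (reaches (Inverts-wk {ν = ν} {θ} e) N))
  (tr-nonvalue M) (tr-nonvalue N)
  (subst₂ NonValueCmp (sym (ren-ren (λ _ → refl) (λ _ → refl) N)) (sym wk-tr)
    (tr-nonvalue {f = suc ∘ f} N))
  where
  wk-tr : renRes su (tr θ N) ≡ tr (λ a x → wkᵗ (θ a x)) N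
  wk-tr = trans (renOut-subOut trm su (tr θ N)) (subᵗ-tr (λ a x → subᵗ-var (λ _ → refl) (θ a x)) N)
reaches {s = trm} {ν = ν} {θ} e (L where:= M) =
  ⟶*-trans (⟶*-where (⌊reaches⌋ (Inverts-liftW {ν = ν} {θ} e) L) (⌊reaches⌋ e M))
    (⟶*-reflexive (sym (inv-Let {ν = ν} ⌊ tr θ M ⌋ ⌊ tr (extW θ) L ⌋)))
reaches {s = jmp} {ν = ν} {θ} e (J where:= M) =
  ⟶*-trans (⟶*-where (reaches (Inverts-liftW {ν = ν} {θ} e) J) (⌊reaches⌋ e M)) (done (≈-sym (base (E3 _ _ _))))
reaches {ν = ν} {θ} e (μ J) =
  ⟶*-trans (⟶*-μ (reaches (Inverts-liftK {ν = ν} {θ} e) J)) (μ⟶*mu (proj₁ (inv (liftK ν) (tr (extK θ) J))) _)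
reaches {ν = ν} {θ} e ([ k ] M) rewrite e K k = ⟶*-[] _ (⌊reaches⌋ e M)

-- Canonical environments and the Church-Rosser property

cx : ℕ → ℕ → Cx
cx zero    zero    = []
cx zero    (suc m) = K ∷ cx zero m
cx (suc n) m       = W ∷ cx n m

θ₀ : ∀ n m → TEnv n m (cx n m)
θ₀ zero    zero    W ()
θ₀ zero    zero    K ()
θ₀ zero    (suc m) = extK (θ₀ zero m)
θ₀ (suc n) m       = extW (θ₀ n m)

ν₀ : ∀ n m → Env (cx n m) n m
ν₀ zero    zero    ()
ν₀ zero    (suc m) = liftK (ν₀ zero m)
ν₀ (suc n) m       = liftW (ν₀ n m)

inverts₀ : ∀ n m → Inverts (ν₀ n m) (θ₀ n m) id id
inverts₀ zero    zero    W ()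
inverts₀ zero    zero    K ()
inverts₀ zero (suc m) W ()
inverts₀ zero (suc m) K k =
  trans (Inverts-liftK {ν = ν₀ zero m} (inverts₀ zero m) K k) (cong (_, _) (lift-id (λ _ → refl) k))
inverts₀ (suc n) m W x =
  trans (Inverts-liftW {ν = ν₀ n m} (inverts₀ n m) W x) (cong var (lift-id (λ _ → refl) x))
inverts₀ (suc n) m K k = Inverts-liftW {ν = ν₀ n m} {θ₀ n m} (inverts₀ n m) K k

reaches₀ : (M : Term n m) → M ⟶* inv (ν₀ n m) ⌊ tr (θ₀ n m) M ⌋
reaches₀ M = ≈-⟶* (≈-reflexive (sym (ren-id (λ _ → refl) (λ _ → refl) M))) (⌊reaches⌋ (inverts₀ _ _) M)

theorem2p1 : ∀ {n m : ℕ} {M₁ M₂ : Term n m} → M₁ =ccv M₂ → ∃[ N ] (M₁ ⟶* N × M₂ ⟶* N)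
theorem2p1 {n} {m} {M₁} {M₂} d with P , p , q ← sound d (θ₀ n m) =
  inv (ν₀ n m) P , ⟶*-trans (reaches₀ M₁) (inv-⇛* p (ν₀ n m)) , ⟶*-trans (reaches₀ M₂) (inv-⇛* q (ν₀ n m))
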